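{- For each of the equational theories $\emptyset$ (the empty theory), $\mathsf{C}=\{f(x,y)\approx f(y,x)\}$, $\mathsf{A}=\{f(x,f(y,z))\approx f(f(x,y),z)\}$, and $\mathsf{I}=\{f(x,x)\approx x\}$, where $f$ is a binary function symbol, the restricted and the unrestricted unification types coincide.
   Context: Let $\Sigma$ be a finite signature, $V$ a countably infinite set of variables, and $T(\Sigma,V)$ the set of terms. For an equational theory $E$, i.e., a set of (implicitly universally quantified) identities between terms, $\approx_E$ is the congruence relation on $T(\Sigma,V)$ it induces ($s\approx_E t$ iff $s\approx t$ holds in all models of $E$). Elementary unification is considered: for $\mathsf{C},\mathsf{A},\mathsf{I}$ the signature is $\Sigma=\{f\}$; for the empty theory, $\Sigma$ is an arbitrary finite signature and $\approx_\emptyset$ is syntactic equality. A substitution is a map $\sigma:V\to T(\Sigma,V)$ with finite domain $\{x\in V\mid\sigma(x)\neq x\}$, extended homomorphically to terms. For $X\subseteq V$, $\sigma\leq_E^X\tau$ iff there is a substitution $\lambda$ with $\lambda(\sigma(x))\approx_E\tau(x)$ for all $x\in X$. An $E$-unification problem is a finite set $\Gamma=\{s_1\approx_E^? t_1,\ldots,s_n\approx_E^? t_n\}$ of equations between terms in $T(\Sigma,V)$; $\mathrm{Var}(\Gamma)$ is the set of variables occurring in it. An $E$-unifier of $\Gamma$ is a substitution $\sigma$ with $\sigma(s_i)\approx_E\sigma(t_i)$ for all $i$; $\Gamma$ is solvable if it has an $E$-unifier. For $\mathrm{Var}(\Gamma)\subseteq X\subseteq V$, a set $S$ of $E$-unifiers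 of $\Gamma$ is complete w.r.t. $\leq_E^X$ if for every $E$-unifier $\theta$ of $\Gamma$ there is $\sigma\in S$ with $\sigma\leq_E^X\theta$; it is minimal if no two distinct elements of $S$ are comparable w.r.t. $\leq_E^X$. Minimal complete sets of the same problem (w.r.t. the same $X$) all have the same cardinality. The unification type of a solvable $\Gamma$ w.r.t. $\leq_E^X$ is: unitary if $\Gamma$ has a minimal complete set of cardinality one; finitary if it has a finite minimal complete set of cardinality greater than one; infinitary if it has an infinite minimal complete set; zero if it has no minimal complete set. The restricted type of $\Gamma$ is the one w.r.t. $\leq_E^{\mathrm{Var}(\Gamma)}$ and the unrestricted type the one w.r.t. $\leq_E^V$. Types are ordered by zero $>$ infinitary $>$ finitary $>$ unitary, and the restricted (unrestricted) type of $E$ is the largest (worst) restricted (unrestricted) type of any solvable $E$-unification problem. -}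

module Defs where

open import Level using (Level; 0ℓ; suc)
open import Data.Fin using (Fin; zero)
open import Data.List using (List)
open import Data.List.Membership.Propositional using (_∈_)
open import Data.List.Relation.Unary.All using (All)
open import Data.List.Relation.Unary.Any using (Any)
open import Data.Nat using (ℕ; _≤_; _>_)
open import Data.Product using (_×_; _,_; proj₁; ∃; ∃-syntax)
open import Data.Sum using (_⊎_)
open import Data.Vec using (Vec; []; _∷_)
import Data.Vec.Relation.Unary.Any as VecAny
open import Data.Vec.Relation.Binary.Pointwise.Inductive using (Pointwise)
open import Function using (_on_)
open import Function.Bundles using (Bijection)
open import Relation.Binary.Bundles using (Setoid)
import Relation.Binary.Construct.On as On
open import Relation.Binary.PropositionalEquality using (_≡_; _≢_)
import Relation.Binary.PropositionalEquality as ≡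
open import Relation.Nullary using (¬_)
open import Relation.Unary using (Pred; U; ｛_｝)

record Signature : Set where
  field
    size  : ℕ
    arity : Fin size → ℕ

  Symbol : Set
  Symbol = Fin size

open Signature public

Var : Set
Var = ℕ

data Term (Sg : Signature) : Set where
  var : Var → Term Sg
  op  : (g : Symbol Sg) → Vec (Term Sg) (arity Sg g) → Term Sg

data Occurs {Sg : Signature} (x : Var) : Term Sg → Set where
  here  : Occurs x (var x)
  there : ∀ {g ts} → VecAny.Any (Occurs x) ts → Occurs x (op g ts)

-- The homomorphic extension of an assignment of variables to the algebra
-- with carrier A and operations I.
module _ {Sg : Signature} {a : Level} {A : Set a}
         (I : (g : Symbol Sg) → Vec A (arity Sg g) → A) (ρ : Var → A) where

  extend     : Term Sg → A
  extendArgs : ∀ {n} → Vec (Term Sg) n → Vec A n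

  extend (var x)   = ρ x
  extend (op g ts) = I g (extendArgs ts)

  extendArgs []       = []
  extendArgs (t ∷ ts) = extend t ∷ extendArgs ts

Identity : Signature → Set
Identity Sg = Term Sg × Term Sg

Theory : Signature → Set₁
Theory Sg = Pred (Identity Sg) 0ℓ

-- Algebras carry a setoid equality, so that quotients such as the term
-- algebra modulo a theory are among them.
record Algebra (Sg : Signature) : Set₁ where
  field
    setoid : Setoid 0ℓ 0ℓ
  open Setoid setoid public
  field
    interp      : (g : Symbol Sg) → Vec Carrier (arity Sg g) → Carrier
    interp-cong : ∀ g {as bs} → Pointwise _≈_ as bs → interp g as ≈ interp g bs

_⊨_ : ∀ {Sg} → Algebra Sg → Identity Sg → Set
M ⊨ (s , t) = ∀ ρ → extend interp ρ s ≈ extend interp ρ t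
  where open Algebra M

_⊨ᵗ_ : ∀ {Sg} → Algebra Sg → Theory Sg → Set
M ⊨ᵗ E = ∀ {e} → E e → M ⊨ e

infix 4 _⊢_≈_

_⊢_≈_ : ∀ {Sg} → Theory Sg → Term Sg → Term Sg → Set₁
_⊢_≈_ {Sg} E s t = (M : Algebra Sg) → M ⊨ᵗ E → M ⊨ (s , t)

record Substitution (Sg : Signature) : Set where
  field
    fun          : Var → Term Sg
    finiteDomain : ∃[ xs ] (∀ x → fun x ≢ var x → x ∈ xs)

open Substitution public

infixr 8 _⟨_⟩

_⟨_⟩ : ∀ {Sg} → Substitution Sg → Term Sg → Term Sg
σ ⟨ t ⟩ = extend op (fun σ) t

-- Substitutions are compared as maps, irrespective of the evidence that the
-- domain is finite.
substitutionSetoid : Signature → Setoid 0ℓ 0ℓ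
substitutionSetoid Sg = On.setoid (Var ≡.→-setoid Term Sg) fun

infix 4 _≐_

_≐_ : ∀ {Sg} → Substitution Sg → Substitution Sg → Set
_≐_ {Sg} = Setoid._≈_ (substitutionSetoid Sg)

-- The level is that of _⊢_≈_, so that sets of substitutions may be defined
-- by comprehension over equality modulo a theory.
SubstitutionSet : Signature → Set₂
SubstitutionSet Sg = Pred (Substitution Sg) (suc 0ℓ)

asSetoid : ∀ {Sg} → SubstitutionSet Sg → Setoid (suc 0ℓ) 0ℓ
asSetoid {Sg} S = On.setoid {B = ∃ S} (substitutionSetoid Sg) proj₁

HasCardinality : ∀ {Sg} → SubstitutionSet Sg → ℕ → Set₁
HasCardinality S n = Bijection (≡.setoid (Fin n)) (asSetoid S)

Finite : ∀ {Sg} → SubstitutionSet Sg → Set₁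
Finite S = ∃[ n ] HasCardinality S n

Problem : Signature → Set
Problem Sg = List (Term Sg × Term Sg)

VarOf : ∀ {Sg} → Problem Sg → Pred Var 0ℓ
VarOf Γ x = Any (λ (s , t) → Occurs x s ⊎ Occurs x t) Γ

data UnificationType : Set where
  unitary finitary infinitary typeZero : UnificationType

severity : UnificationType → ℕ
severity unitary    = 0
severity finitary   = 1
severity infinitary = 2
severity typeZero   = 3

infix 4 _≤ᵗ_

_≤ᵗ_ : UnificationType → UnificationType → Set
_≤ᵗ_ = _≤_ on severity

module _ {Sg : Signature} (E : Theory Sg) where

  IsUnifier : Problem Sg → Substitution Sg → Set₁
  IsUnifier Γ σ = All (λ (s , t) → E ⊢ σ ⟨ s ⟩ ≈ σ ⟨ t ⟩) Γ

  Solvable : Problem Sg → Set₁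
  Solvable Γ = ∃[ σ ] IsUnifier Γ σ

  MoreGeneral : Pred Var 0ℓ → Substitution Sg → Substitution Sg → Set₁
  MoreGeneral X σ τ = ∃[ δ ] (∀ x → X x → E ⊢ δ ⟨ fun σ x ⟩ ≈ fun τ x)

  record IsMinimalComplete (Γ : Problem Sg) (X : Pred Var 0ℓ)
                           (S : SubstitutionSet Sg) : Set₁ where
    field
      unifiers : ∀ {σ} → S σ → IsUnifier Γ σ
      complete : ∀ {θ} → IsUnifier Γ θ → ∃[ σ ] S σ × MoreGeneral X σ θ
      minimal  : ∀ {σ τ} → S σ → S τ → ¬ (σ ≐ τ) →
                 ¬ (MoreGeneral X σ τ ⊎ MoreGeneral X τ σ)

  HasType : Problem Sg → Pred Var 0ℓ → UnificationType → Set₂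
  HasType Γ X unitary    = ∃[ S ] IsMinimalComplete Γ X S × HasCardinality S 1
  HasType Γ X finitary   = ∃[ S ] IsMinimalComplete Γ X S ×
                           ∃[ n ] n > 1 × HasCardinality S n
  HasType Γ X infinitary = ∃[ S ] IsMinimalComplete Γ X S × ¬ Finite S
  HasType Γ X typeZero   = ¬ (∃[ S ] IsMinimalComplete Γ X S)

  -- "τ is the largest type of a solvable problem", where X assigns to each
  -- problem the set of variables on which substitutions are compared.
  IsWorstType : (X : Problem Sg → Pred Var 0ℓ) → UnificationType → Set₂
  IsWorstType X τ =
    (∃[ Γ ] Solvable Γ × HasType Γ (X Γ) τ) ×
    (∀ Γ → Solvable Γ → ∀ τ′ → HasType Γ (X Γ) τ′ → τ′ ≤ᵗ τ)

  IsRestrictedType : UnificationType → Set₂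
  IsRestrictedType = IsWorstType VarOf

  IsUnrestrictedType : UnificationType → Set₂
  IsUnrestrictedType = IsWorstType (λ _ → U)

  -- A worst type is unique, by antisymmetry of _≤ᵗ_.
  TypesCoincide : Set₂
  TypesCoincide = ∃[ τ ] IsRestrictedType τ × IsUnrestrictedType τ

binary : Signature
binary = record { size = 1 ; arity = λ _ → 2 }

f : Term binary → Term binary → Term binary
f s t = op zero (s ∷ t ∷ [])

private
  x y z : Term binary
  x = var 0
  y = var 1
  z = var 2

C A I : Theory binary
C = ｛ f x y , f y x ｝
A = ｛ f x (f y z) , f (f x y) z ｝
I = ｛ f x x , x ｝

{-# OPTIONS --safe #-}

-- The types are unitary (∅), finitary (C, I) and infinitary (A), for either
-- choice of the set of variables on which substitutions are compared. In each
-- case one family of unifiers is complete w.r.t. all variables while its members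
-- are incomparable already on the variables of the problem.
--
-- For ∅ the family is a most general unifier. For C and I, evaluation in a term
-- algebra of normal forms is a choice, at every node f s t of a term, between
-- f s t and one alternative (f t s for C, and s together with s ≈ t for I), so
-- that a problem reduces to finitely many syntactic ones. A finite complete
-- family excludes the types infinitary and zero, because it can be pruned to an
-- irredundant one and every minimal complete set is equipotent with the latter.
--
-- For A, terms are nonempty words. In an equation xu ≈ yv with x ≠ y a unifier
-- makes the values of x and y equal, or one a proper prefix of the other, and the
-- case is determined by the lengths of the values. Eliminating x or y accordingly
-- and cancelling solves the problem along a path of cases which comparable
-- unifiers share. So the solutions of the paths form a minimal complete set. For
-- xy ≈ yx there are infinitely many paths.

module Submission where

open import Data.Empty using (⊥-elim)
open import Data.Fin using (Fin; zero; suc; punchIn; punchOut; toℕ)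
import Data.Fin.Properties as Fin
open import Data.List using (List; []; _∷_; _++_; map; [_]; concatMap; length; lookup;
  cartesianProduct; cartesianProductWith)
open import Data.List.Membership.Propositional using (_∈_; find; lose)
open import Data.List.Membership.Propositional.Properties using (∈-++⁺ˡ; ∈-++⁺ʳ; ∈-++⁻; ∈-lookup;
  ∈-cartesianProductWith⁺; ∈-cartesianProductWith⁻; ∈-cartesianProduct⁺; ∈-cartesianProduct⁻)
import Data.List.Properties as List
open import Data.List.Relation.Unary.All as All using (All; []; _∷_)
import Data.List.Relation.Unary.All.Properties as All
open import Data.List.Relation.Unary.Any using (Any; here; there; index)
open import Data.List.Relation.Unary.Any.Properties using (lookup-index)
open import Data.Nat using (ℕ; zero; suc; _≤_; _<_; _>_; _+_; _*_; z≤n; s≤s; _≤?_)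
import Data.Nat.Properties as ℕ
open import Data.Product as Product using (_×_; _,_; proj₁; proj₂; ∃; ∃-syntax; ∃₂)
open import Data.Sum as Sum using (_⊎_; inj₁; inj₂)
open import Data.Vec as Vec using (Vec; []; _∷_)
open import Data.Vec.Relation.Binary.Pointwise.Inductive using ([]; _∷_; Pointwise-≡⇒≡)
import Data.Vec.Relation.Unary.Any as VecAny
open import Function using (_∘_; id)
open import Function.Bundles using (Bijection; Surjection)
open import Level using (0ℓ; Lift; lift) renaming (suc to lsuc)
open import Relation.Binary.Bundles using (Setoid)
open import Relation.Binary.PropositionalEquality as ≡ hiding (setoid; [_])
open import Relation.Nullary using (¬_; Dec; yes; no; contradiction)
open import Relation.Nullary.Decidable using (decidable-stable; ¬¬-excluded-middle)
open import Relation.Unary using (Pred; U; ∅; _⊆_)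
open import Defs

private variable
  Sg : Signature
  n  : ℕ

-- Terms and substitutions

op-injective : ∀ {g} {ts us : Vec (Term Sg) (arity Sg g)} → op {Sg} g ts ≡ op g us → ts ≡ us
op-injective refl = refl

op-injective-symbol : ∀ {g h ts us} → op {Sg} g ts ≡ op h us → g ≡ h
op-injective-symbol refl = refl

infix 4 _≟_ _≟*_

_≟_  : (s t : Term Sg) → Dec (s ≡ t)
_≟*_ : (ss ts : Vec (Term Sg) n) → Dec (ss ≡ ts)

var x ≟ var y with x ℕ.≟ y
... | yes refl = yes refl
... | no x≢y   = no λ { refl → x≢y refl }
var _ ≟ op _ _ = no λ ()
op _ _ ≟ var _ = no λ ()
op g ss ≟ op h ts with g Fin.≟ h
... | no g≢h = no (g≢h ∘ op-injective-symbol)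
... | yes refl with ss ≟* ts
...   | yes refl = yes refl
...   | no ss≢ts = no (ss≢ts ∘ op-injective)

[]       ≟* []       = yes refl
(s ∷ ss) ≟* (t ∷ ts) with s ≟ t | ss ≟* ts
... | yes refl | yes refl = yes refl
... | no s≢t   | _        = no λ { refl → s≢t refl }
... | _        | no ss≢ts = no λ { refl → ss≢ts refl }

module _ {a} {B : Set a} (J : (g : Symbol Sg) → Vec B (arity Sg g) → B) where

  extend-∘     : ∀ ρ (σ : Var → Term Sg) t →
                 extend J ρ (extend op σ t) ≡ extend J (extend J ρ ∘ σ) t
  extendArgs-∘ : ∀ ρ (σ : Var → Term Sg) (ts : Vec (Term Sg) n) →
                 extendArgs J ρ (extendArgs op σ ts) ≡ extendArgs J (extend J ρ ∘ σ) ts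

  extend-∘ ρ σ (var x)   = refl
  extend-∘ ρ σ (op g ts) = cong (J g) (extendArgs-∘ ρ σ ts)

  extendArgs-∘ ρ σ []       = refl
  extendArgs-∘ ρ σ (t ∷ ts) = cong₂ _∷_ (extend-∘ ρ σ t) (extendArgs-∘ ρ σ ts)

  extend-cong     : ∀ {ρ ρ′} → ρ ≗ ρ′ → extend J ρ ≗ extend J ρ′
  extendArgs-cong : ∀ {ρ ρ′} → ρ ≗ ρ′ → extendArgs J ρ {n} ≗ extendArgs J ρ′

  extend-cong eq (var x)   = eq x
  extend-cong eq (op g ts) = cong (J g) (extendArgs-cong eq ts)

  extendArgs-cong eq []       = refl
  extendArgs-cong eq (t ∷ ts) = cong₂ _∷_ (extend-cong eq t) (extendArgs-cong eq ts)

extend-var     : (t : Term Sg) → extend op var t ≡ t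
extendArgs-var : (ts : Vec (Term Sg) n) → extendArgs op var ts ≡ ts

extend-var (var x)   = refl
extend-var (op g ts) = cong (op g) (extendArgs-var ts)

extendArgs-var []       = refl
extendArgs-var (t ∷ ts) = cong₂ _∷_ (extend-var t) (extendArgs-var ts)

idₛ : Substitution Sg
idₛ = record { fun = var ; finiteDomain = [] , λ x x≢ → contradiction refl x≢ }

infixr 9 _∘ₛ_

_∘ₛ_ : Substitution Sg → Substitution Sg → Substitution Sg
σ ∘ₛ τ = record
  { fun          = λ x → σ ⟨ fun τ x ⟩
  ; finiteDomain = proj₁ (finiteDomain σ) ++ proj₁ (finiteDomain τ) , moved
  }
  where
  moved : ∀ x → σ ⟨ fun τ x ⟩ ≢ var x →
          x ∈ proj₁ (finiteDomain σ) ++ proj₁ (finiteDomain τ)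
  moved x ne with fun τ x ≟ var x
  ... | no τx≢x  = ∈-++⁺ʳ _ (proj₂ (finiteDomain τ) x τx≢x)
  ... | yes τx≡x = ∈-++⁺ˡ (proj₂ (finiteDomain σ) x λ σx≡x →
                     ne (trans (cong (σ ⟨_⟩) τx≡x) σx≡x))

infixl 10 _[_↦_]

_[_↦_] : Substitution Sg → Var → Term Sg → Substitution Sg
_[_↦_] {Sg} σ y t = record { fun = updated ; finiteDomain = y ∷ proj₁ (finiteDomain σ) , moved }
  where
  updated : Var → Term Sg
  updated x with x ℕ.≟ y
  ... | yes _ = t
  ... | no  _ = fun σ x

  moved : ∀ x → updated x ≢ var x → x ∈ y ∷ proj₁ (finiteDomain σ)
  moved x ne with x ℕ.≟ y
  ... | yes x≡y = here x≡y
  ... | no  _   = there (proj₂ (finiteDomain σ) x ne)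

updated-at : ∀ (σ : Substitution Sg) y t → fun (σ [ y ↦ t ]) y ≡ t
updated-at σ y t with y ℕ.≟ y
... | yes _  = refl
... | no y≢y = contradiction refl y≢y

updated-off : ∀ (σ : Substitution Sg) {x y} t → x ≢ y → fun (σ [ y ↦ t ]) x ≡ fun σ x
updated-off σ {x} {y} t x≢y with x ℕ.≟ y
... | yes x≡y = contradiction x≡y x≢y
... | no  _   = refl

∘ₛ-⟨⟩ : ∀ (σ τ : Substitution Sg) t → (σ ∘ₛ τ) ⟨ t ⟩ ≡ σ ⟨ τ ⟨ t ⟩ ⟩
∘ₛ-⟨⟩ σ τ t = sym (extend-∘ op (fun σ) (fun τ) t)

-- Equality of terms is decidable at each variable. This recovers an identity of substitutions from
-- minimality, which only refutes their being distinct.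
≐-stable : ∀ {σ τ : Substitution Sg} → ¬ ¬ (σ ≐ τ) → σ ≐ τ
≐-stable ¬¬eq x = decidable-stable (_ ≟ _) λ ne → ¬¬eq λ eq → ne (eq x)

-- Equality modulo a theory

module _ {E : Theory Sg} where

  ≡⇒⊢ : ∀ {s t} → s ≡ t → E ⊢ s ≈ t
  ≡⇒⊢ refl M _ ρ = Algebra.refl M

  ⊢-sym : ∀ {s t} → E ⊢ s ≈ t → E ⊢ t ≈ s
  ⊢-sym p M m ρ = Algebra.sym M (p M m ρ)

  ⊢-trans : ∀ {s t u} → E ⊢ s ≈ t → E ⊢ t ≈ u → E ⊢ s ≈ u
  ⊢-trans p q M m ρ = Algebra.trans M (p M m ρ) (q M m ρ)

  ⊢-⟨⟩ : ∀ (σ : Substitution Sg) {s t} → E ⊢ s ≈ t → E ⊢ σ ⟨ s ⟩ ≈ σ ⟨ t ⟩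
  ⊢-⟨⟩ σ {s} {t} p M m ρ = begin
    extend interp ρ (σ ⟨ s ⟩)                  ≡⟨ extend-∘ interp ρ (fun σ) s ⟩
    extend interp (extend interp ρ ∘ fun σ) s  ≈⟨ p M m _ ⟩
    extend interp (extend interp ρ ∘ fun σ) t  ≡⟨ extend-∘ interp ρ (fun σ) t ⟨
    extend interp ρ (σ ⟨ t ⟩)                  ∎
    where
    open Algebra M
    open import Relation.Binary.Reasoning.Setoid setoid

⊢-setoid : Theory Sg → Setoid 0ℓ (lsuc 0ℓ)
⊢-setoid {Sg} E = record
  { Carrier       = Term Sg
  ; _≈_           = E ⊢_≈_
  ; isEquivalence = record
    { refl  = λ {s} → ≡⇒⊢ {s = s} refl
    ; sym   = λ {s} {t} → ⊢-sym {s = s} {t}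
    ; trans = λ {s} {t} {u} → ⊢-trans {s = s} {t} {u}
    }
  }

-- Minimal complete sets as ranges of families

module _ {E : Theory Sg} where

  ≐⇒MoreGeneral : ∀ {X} σ τ → σ ≐ τ → MoreGeneral E X σ τ
  ≐⇒MoreGeneral σ τ eq = idₛ , λ x _ → ≡⇒⊢ (trans (extend-var (fun σ x)) (eq x))

  MoreGeneral-trans : ∀ {X} σ τ υ → MoreGeneral E X σ τ → MoreGeneral E X τ υ → MoreGeneral E X σ υ
  MoreGeneral-trans σ τ υ (δ , p) (δ′ , q) = δ′ ∘ₛ δ , λ x x∈X → begin
    (δ′ ∘ₛ δ) ⟨ fun σ x ⟩   ≡⟨ ∘ₛ-⟨⟩ δ′ δ (fun σ x) ⟩
    δ′ ⟨ δ ⟨ fun σ x ⟩ ⟩    ≈⟨ ⊢-⟨⟩ δ′ {δ ⟨ fun σ x ⟩} {fun τ x} (p x x∈X) ⟩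
    δ′ ⟨ fun τ x ⟩          ≈⟨ q x x∈X ⟩
    fun υ x                 ∎
    where open import Relation.Binary.Reasoning.Setoid (⊢-setoid E)

  MoreGeneral-antimono : ∀ {X Y} σ τ → X ⊆ Y → MoreGeneral E Y σ τ → MoreGeneral E X σ τ
  MoreGeneral-antimono σ τ X⊆Y (δ , p) = δ , λ x x∈X → p x (X⊆Y x∈X)

  -- Closing the image under `≐` makes membership independent of the evidence for finite domains.
  Range : {K : Set} → (K → Substitution Sg) → SubstitutionSet Sg
  Range fam σ = Lift (lsuc 0ℓ) (∃[ k ] fam k ≐ σ)

  module _ {Γ : Problem Sg} where

    IsUnifier-resp-≐ : ∀ σ τ → σ ≐ τ → IsUnifier E Γ σ → IsUnifier E Γ τ
    IsUnifier-resp-≐ σ τ eq = All.map λ {(s , t)} p →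
      subst₂ (E ⊢_≈_) (extend-cong op eq s) (extend-cong op eq t) p

    record IsComplete {K : Set} (X : Pred Var 0ℓ) (fam : K → Substitution Sg) : Set₁ where
      field
        unifiers : ∀ k → IsUnifier E Γ (fam k)
        complete : ∀ θ → IsUnifier E Γ θ → ∃[ k ] MoreGeneral E X (fam k) θ

    open IsComplete

    IsComplete-antimono : ∀ {K X Y} {fam : K → Substitution Sg} → X ⊆ Y →
                          IsComplete Y fam → IsComplete X fam
    IsComplete-antimono X⊆Y c .unifiers   = c .unifiers
    IsComplete-antimono {fam = fam} X⊆Y c .complete θ u =
      let k , le = c .complete θ u in k , MoreGeneral-antimono (fam k) θ X⊆Y le

    Irredundant : {K : Set} → Pred Var 0ℓ → (K → Substitution Sg) → Set₁
    Irredundant X fam = ∀ i j → MoreGeneral E X (fam i) (fam j) → i ≡ j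

    -- Comparable members need only be equal as maps: the family for `A` is indexed by derivations,
    -- whose equality would be a stronger demand.
    range-isMinimalComplete : ∀ {K X} {fam : K → Substitution Sg} → IsComplete X fam →
      (∀ i j → MoreGeneral E X (fam i) (fam j) → fam i ≐ fam j) →
      IsMinimalComplete E Γ X (Range fam)
    range-isMinimalComplete {X = X} {fam} c min = record
      { unifiers = λ { {σ} (lift (k , eq)) → IsUnifier-resp-≐ (fam k) σ eq (c .unifiers k) }
      ; complete = λ {θ} u → let k , le = c .complete θ u in fam k , lift (k , λ _ → refl) , le
      ; minimal  = λ { {σ} {τ} (lift (i , p)) (lift (j , q)) σ≢τ → λ where
          (inj₁ le) → σ≢τ (comparable i j σ τ p q le)
          (inj₂ le) → σ≢τ (sym ∘ comparable j i τ σ q p le) }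
      }
      where
      comparable : ∀ i j σ τ → fam i ≐ σ → fam j ≐ τ → MoreGeneral E X σ τ → σ ≐ τ
      comparable i j σ τ p q le x = trans (sym (p x)) (trans (i≐j x) (q x))
        where
        i≐j : fam i ≐ fam j
        i≐j = min i j (MoreGeneral-trans (fam i) σ (fam j) (≐⇒MoreGeneral (fam i) σ p)
                (MoreGeneral-trans σ τ (fam j) le (≐⇒MoreGeneral τ (fam j) (sym ∘ q))))

    -- Completeness of `S` and of `fam` gives maps in both directions, each leading to something
    -- more general. A round trip therefore ends at something more general than its start, hence at
    -- the start itself, by minimality of `S` or irredundancy of `fam`.
    cardinality : ∀ {X S} {fam : Fin n → Substitution Sg} → IsComplete X fam → Irredundant X fam →
                  IsMinimalComplete E Γ X S → HasCardinality S n
    cardinality {n} {X} {S} {fam} c irr S-mc = record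
      { to        = λ i → member i , member∈S i
      ; cong      = λ { refl _ → refl }
      ; bijective = injective , λ { (σ , σ∈S) → covering σ∈S , λ { refl → covered σ∈S } }
      }
      where
      module S = IsMinimalComplete S-mc

      member : Fin n → Substitution Sg
      member i = proj₁ (S.complete {fam i} (c .unifiers i))

      member∈S : ∀ i → S (member i)
      member∈S i = proj₁ (proj₂ (S.complete {fam i} (c .unifiers i)))

      member≤ : ∀ i → MoreGeneral E X (member i) (fam i)
      member≤ i = proj₂ (proj₂ (S.complete {fam i} (c .unifiers i)))

      covering : ∀ {σ} → S σ → Fin n
      covering {σ} σ∈S = proj₁ (c .complete σ (S.unifiers σ∈S))

      covering≤ : ∀ {σ} (σ∈S : S σ) → MoreGeneral E X (fam (covering σ∈S)) σ
      covering≤ {σ} σ∈S = proj₂ (c .complete σ (S.unifiers σ∈S))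

      covered : ∀ {σ} (σ∈S : S σ) → member (covering σ∈S) ≐ σ
      covered {σ} σ∈S = ≐-stable {σ = member k} {τ = σ} λ ne → S.minimal (member∈S k) σ∈S ne
        (inj₁ (MoreGeneral-trans (member k) (fam k) σ (member≤ k) (covering≤ σ∈S)))
        where k = covering σ∈S

      injective : ∀ {i j} → member i ≐ member j → i ≡ j
      injective {i} {j} eq = trans (sym (irr k i k≤i)) (irr k j k≤j)
        where
        k = covering (member∈S i)
        k≤ : MoreGeneral E X (fam k) (member i)
        k≤ = covering≤ (member∈S i)
        k≤i : MoreGeneral E X (fam k) (fam i)
        k≤i = MoreGeneral-trans (fam k) (member i) (fam i) k≤ (member≤ i)
        k≤j : MoreGeneral E X (fam k) (fam j)
        k≤j = MoreGeneral-trans (fam k) (member i) (fam j) k≤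
                (MoreGeneral-trans (member i) (member j) (fam j)
                  (≐⇒MoreGeneral (member i) (member j) eq) (member≤ j))

    prune : ∀ {X} n (fam : Fin n → Substitution Sg) → IsComplete X fam →
            ¬ ¬ (∃[ m ] ∃[ fam′ ] IsComplete {Fin m} X fam′ × Irredundant X fam′)
    prune zero fam c k = k (zero , fam , c , λ ())
    prune {X} (suc n) fam c k = ¬¬-excluded-middle {A = redundant} λ where
        (yes (i , j , i≢j , i≤j)) → prune n (fam ∘ punchIn j) (without i j i≢j i≤j) k
        (no irr) → k (suc n , fam , c , λ i j i≤j →
          decidable-stable (i Fin.≟ j) λ i≢j → irr (i , j , i≢j , i≤j))
      where
      redundant : Set₁
      redundant = ∃₂ λ i j → i ≢ j × MoreGeneral E X (fam i) (fam j)

      without : ∀ i j → i ≢ j → MoreGeneral E X (fam i) (fam j) → IsComplete X (fam ∘ punchIn j)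
      without i j i≢j i≤j .unifiers l = c .unifiers (punchIn j l)
      without i j i≢j i≤j .complete θ u with c .complete θ u
      ... | l , l≤θ with l Fin.≟ j
      ...   | no l≢j   = punchOut (l≢j ∘ sym) ,
                subst (λ l → MoreGeneral E X (fam l) θ) (sym (Fin.punchIn-punchOut (l≢j ∘ sym))) l≤θ
      ...   | yes refl = punchOut (i≢j ∘ sym) ,
                subst (λ l → MoreGeneral E X (fam l) θ) (sym (Fin.punchIn-punchOut (i≢j ∘ sym)))
                  (MoreGeneral-trans (fam i) (fam l) θ i≤j l≤θ)

  FinitelyComplete : Problem Sg → Set₁
  FinitelyComplete Γ = ∃[ n ] ∃[ fam ] IsComplete {Γ} {Fin n} U fam

  module _ {Γ : Problem Sg} {X : Pred Var 0ℓ} (fc : ¬ ¬ FinitelyComplete Γ) where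

    irredundant : ¬ ¬ (∃[ m ] ∃[ fam ] IsComplete {Γ} {Fin m} X fam × Irredundant {Γ} X fam)
    irredundant k = fc λ (n , fam , c) → prune n fam (IsComplete-antimono (λ _ → _) c) k

    ¬infinitary : ¬ HasType E Γ X infinitary
    ¬infinitary (S , mc , ¬finite) = irredundant λ (m , fam , c , irr) →
      ¬finite (m , cardinality c irr mc)

    ¬typeZero : ¬ HasType E Γ X typeZero
    ¬typeZero ¬mc = irredundant λ (m , fam , c , irr) →
      ¬mc (_ , range-isMinimalComplete c λ i j le → cong-app (cong (fun ∘ fam) (irr i j le)))

    -- Doubly negated finite completeness suffices, since the two worse types only have to be
    -- refuted.
    type≤finitary : ∀ τ → HasType E Γ X τ → τ ≤ᵗ finitary
    type≤finitary unitary    _ = z≤n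
    type≤finitary finitary   _ = s≤s z≤n
    type≤finitary infinitary h = ⊥-elim (¬infinitary h)
    type≤finitary typeZero   h = ⊥-elim (¬typeZero h)

  mgu⇒type≤unitary : ∀ {Γ X} {fam : Fin 1 → Substitution Sg} → IsComplete {Γ} U fam →
                     ∀ τ → HasType E Γ X τ → τ ≤ᵗ unitary
  mgu⇒type≤unitary c unitary    _ = z≤n
  mgu⇒type≤unitary c infinitary h = ⊥-elim (¬infinitary (λ k → k (_ , _ , c)) h)
  mgu⇒type≤unitary c typeZero   h = ⊥-elim (¬typeZero (λ k → k (_ , _ , c)) h)
  -- By `cardinality` the set also has exactly one element, so two distinct indices of `bij` would
  -- name the same substitution.
  mgu⇒type≤unitary c finitary (S , mc , suc (suc n) , s≤s (s≤s z≤n) , bij) =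
    contradiction (Bijection.injective bij same) λ ()
    where
    one = cardinality (IsComplete-antimono (λ _ → _) c) (λ { zero zero _ → refl }) mc

    unique : ∀ s x → fun (proj₁ (Bijection.to one zero)) x ≡ fun (proj₁ s) x
    unique s x with Bijection.surjective one s
    ... | zero , eq = eq refl x

    same : proj₁ (Bijection.to bij zero) ≐ proj₁ (Bijection.to bij (suc zero))
    same x = trans (sym (unique (Bijection.to bij zero) x)) (unique (Bijection.to bij (suc zero)) x)

  -- Completeness passes to fewer variables and irredundancy to more, so one family satisfying both
  -- hypotheses settles both types.
  finitary-example : ∀ {Γ n} {fam : Fin n → Substitution Sg} → n > 1 →
    IsComplete {Γ} U fam → Irredundant {Γ} (VarOf Γ) fam →
    HasType E Γ (VarOf Γ) finitary × HasType E Γ U finitary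
  finitary-example {Γ} {n} {fam} n>1 c irr =
      typed (IsComplete-antimono (λ _ → _) c) irr
    , typed c λ i j le → irr i j (MoreGeneral-antimono (fam i) (fam j) (λ _ → _) le)
    where
    typed : ∀ {X} → IsComplete {Γ} X fam → Irredundant {Γ} X fam → HasType E Γ X finitary
    typed c irr = _ , mc , _ , n>1 , cardinality c irr mc
      where mc = range-isMinimalComplete c λ i j le → cong-app (cong (fun ∘ fam) (irr i j le))

-- Syntactic unification

Unifies : Substitution Sg → Problem Sg → Set
Unifies σ = All λ (s , t) → σ ⟨ s ⟩ ≡ σ ⟨ t ⟩

infix 4 _⊑_

_⊑_ : Substitution Sg → Substitution Sg → Set
μ ⊑ τ = ∃[ δ ] δ ∘ₛ μ ≐ τ

IsMgu : Substitution Sg → Problem Sg → Set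
IsMgu μ Γ = Unifies μ Γ × (∀ τ → Unifies τ Γ → μ ⊑ τ)

∣_∣  : Term Sg → ℕ
∣_∣* : Vec (Term Sg) n → ℕ

∣ var x ∣   = 1
∣ op g ts ∣ = suc ∣ ts ∣*

∣ [] ∣*     = 0
∣ t ∷ ts ∣* = ∣ t ∣ + ∣ ts ∣*

0<∣_∣ : (t : Term Sg) → 0 < ∣ t ∣
0<∣ var x ∣   = s≤s z≤n
0<∣ op g ts ∣ = s≤s z≤n

-- Left-hand sides suffice, as under a unifier both sides have the same size.
weight : Substitution Sg → Problem Sg → ℕ
weight θ []            = 0
weight θ ((s , _) ∷ Γ) = ∣ θ ⟨ s ⟩ ∣ + weight θ Γ

infixr 8 _⟨_⟩ₚ

_⟨_⟩ₚ : Substitution Sg → Problem Sg → Problem Sg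
σ ⟨ Γ ⟩ₚ = map (λ (s , t) → σ ⟨ s ⟩ , σ ⟨ t ⟩) Γ

Unifies-∘⁺ : ∀ (σ τ : Substitution Sg) Γ → Unifies σ (τ ⟨ Γ ⟩ₚ) → Unifies (σ ∘ₛ τ) Γ
Unifies-∘⁺ σ τ Γ u = All.map
  (λ {(s , t)} eq → trans (∘ₛ-⟨⟩ σ τ s) (trans eq (sym (∘ₛ-⟨⟩ σ τ t)))) (All.map⁻ u)

Unifies-∘⁻ : ∀ (σ τ : Substitution Sg) Γ → Unifies (σ ∘ₛ τ) Γ → Unifies σ (τ ⟨ Γ ⟩ₚ)
Unifies-∘⁻ σ τ Γ u = All.map⁺ (All.map
  (λ {(s , t)} eq → trans (sym (∘ₛ-⟨⟩ σ τ s)) (trans eq (∘ₛ-⟨⟩ σ τ t))) u)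

Unifies-resp-≐ : ∀ {σ τ : Substitution Sg} {Γ} → σ ≐ τ → Unifies σ Γ → Unifies τ Γ
Unifies-resp-≐ eq = All.map λ {(s , t)} p →
  trans (sym (extend-cong op eq s)) (trans p (extend-cong op eq t))

weight-∘ : ∀ (σ τ : Substitution Sg) Γ → weight σ (τ ⟨ Γ ⟩ₚ) ≡ weight (σ ∘ₛ τ) Γ
weight-∘ σ τ []            = refl
weight-∘ σ τ ((s , t) ∷ Γ) = cong₂ _+_ (cong ∣_∣ (sym (∘ₛ-⟨⟩ σ τ s))) (weight-∘ σ τ Γ)

weight-cong : ∀ {σ τ : Substitution Sg} → σ ≐ τ → weight σ ≗ weight τ
weight-cong eq []            = refl
weight-cong eq ((s , t) ∷ Γ) = cong₂ _+_ (cong ∣_∣ (extend-cong op eq s)) (weight-cong eq Γ)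

equate : Vec (Term Sg) n → Vec (Term Sg) n → Problem Sg → Problem Sg
equate []       []       Γ = Γ
equate (s ∷ ss) (t ∷ ts) Γ = (s , t) ∷ equate ss ts Γ

module _ (σ : Substitution Sg) {Γ : Problem Sg} where

  equate⁺ : (ss ts : Vec (Term Sg) n) → extendArgs op (fun σ) ss ≡ extendArgs op (fun σ) ts →
            Unifies σ Γ → Unifies σ (equate ss ts Γ)
  equate⁺ []       []       _  u = u
  equate⁺ (s ∷ ss) (t ∷ ts) eq u =
    cong Vec.head eq ∷ equate⁺ ss ts (cong Vec.tail eq) u

  equate⁻ : (ss ts : Vec (Term Sg) n) → Unifies σ (equate ss ts Γ) →
            extendArgs op (fun σ) ss ≡ extendArgs op (fun σ) ts × Unifies σ Γ
  equate⁻ []       []       u       = refl , u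
  equate⁻ (s ∷ ss) (t ∷ ts) (p ∷ u) = let q , v = equate⁻ ss ts u in cong₂ _∷_ p q , v

  weight-equate : (ss ts : Vec (Term Sg) n) →
                  weight σ (equate ss ts Γ) ≡ ∣ extendArgs op (fun σ) ss ∣* + weight σ Γ
  weight-equate []       []       = refl
  weight-equate (s ∷ ss) (t ∷ ts) =
    trans (cong (∣ σ ⟨ s ⟩ ∣ +_) (weight-equate ss ts)) (sym (ℕ.+-assoc ∣ σ ⟨ s ⟩ ∣ _ _))

-- The occurs check, phrased by its consequences: without `x` in `t` an elimination leaves `t`
-- fixed, and a proper occurrence makes `x ≈ t` unsolvable. For argument lists the bound is not
-- strict; the enclosing `op` adds the missing one.
fixes-or-grows  : ∀ x (t : Term Sg) → t ≡ var x ⊎ (∀ s → (idₛ [ x ↦ s ]) ⟨ t ⟩ ≡ t) ⊎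
                  (∀ θ → ∣ fun θ x ∣ < ∣ θ ⟨ t ⟩ ∣)
fixes-or-grows* : ∀ x (ts : Vec (Term Sg) n) →
                  (∀ s → extendArgs op (fun (idₛ [ x ↦ s ])) ts ≡ ts) ⊎
                  (∀ θ → ∣ fun θ x ∣ ≤ ∣ extendArgs op (fun θ) ts ∣*)

fixes-or-grows x (var y) with y ℕ.≟ x
... | yes refl = inj₁ refl
... | no y≢x   = inj₂ (inj₁ λ s → refl)
fixes-or-grows x (op g ts) with fixes-or-grows* x ts
... | inj₁ fixed = inj₂ (inj₁ λ s → cong (op g) (fixed s))
... | inj₂ grows = inj₂ (inj₂ λ θ → s≤s (grows θ))

fixes-or-grows* x []       = inj₁ λ s → refl
fixes-or-grows* x (t ∷ ts) with fixes-or-grows x t | fixes-or-grows* x ts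
... | inj₁ refl         | _          = inj₂ λ θ → ℕ.m≤m+n _ _
... | inj₂ (inj₂ grows) | _          = inj₂ λ θ → ℕ.≤-trans (ℕ.<⇒≤ (grows θ)) (ℕ.m≤m+n _ _)
... | inj₂ (inj₁ _)     | inj₂ grows = inj₂ λ θ → ℕ.≤-trans (grows θ) (ℕ.m≤n+m _ _)
... | inj₂ (inj₁ fixed) | inj₁ fixed* = inj₁ λ s → cong₂ _∷_ (fixed s) (fixed* s)

-- A unifier of x ≈ t absorbs the elimination of x.
absorbs : ∀ (τ : Substitution Sg) {x t} → fun τ x ≡ τ ⟨ t ⟩ → τ ∘ₛ idₛ [ x ↦ t ] ≐ τ
absorbs τ {x} eq z with z ℕ.≟ x
... | yes refl = sym eq
... | no  _    = refl

⊑-∘ : ∀ {μ τ ε : Substitution Sg} → μ ⊑ τ → τ ∘ₛ ε ≐ τ → μ ∘ₛ ε ⊑ τ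
⊑-∘ {μ = μ} {τ} {ε} (δ , δμ≐τ) τε≐τ = δ , λ z → begin
  δ ⟨ μ ⟨ fun ε z ⟩ ⟩   ≡⟨ ∘ₛ-⟨⟩ δ μ (fun ε z) ⟨
  (δ ∘ₛ μ) ⟨ fun ε z ⟩  ≡⟨ extend-cong op δμ≐τ (fun ε z) ⟩
  τ ⟨ fun ε z ⟩         ≡⟨ τε≐τ z ⟩
  fun τ z               ∎
  where open ≡-Reasoning

-- A unifier `τ` of the whole problem absorbs `ε`, so it unifies `ε ⟨ Γ ⟩ₚ` and factors through `μ`.
-- Composing with `ε` again changes nothing, whence `τ` factors through `μ ∘ₛ ε`.
eliminate : ∀ {μ x} {t : Term Sg} {Γ} → (idₛ [ x ↦ t ]) ⟨ t ⟩ ≡ t →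
            IsMgu μ (idₛ [ x ↦ t ] ⟨ Γ ⟩ₚ) → IsMgu (μ ∘ₛ idₛ [ x ↦ t ]) ((var x , t) ∷ Γ)
eliminate {μ = μ} {x} {t} {Γ} fixed (u , general) =
    (head ∷ Unifies-∘⁺ μ ε Γ u)
  , λ { τ (p ∷ v) → ⊑-∘ {μ = μ} {τ = τ} {ε = ε}
      (general τ (Unifies-∘⁻ τ ε Γ (Unifies-resp-≐ {σ = τ} {τ = τ ∘ₛ ε} (sym ∘ absorbs τ p) v)))
      (absorbs τ p) }
  where
  open ≡-Reasoning
  ε = idₛ [ x ↦ t ]
  head : (μ ∘ₛ ε) ⟨ var x ⟩ ≡ (μ ∘ₛ ε) ⟨ t ⟩
  head = begin
    μ ⟨ fun ε x ⟩   ≡⟨ cong (μ ⟨_⟩) (updated-at idₛ x t) ⟩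
    μ ⟨ t ⟩         ≡⟨ cong (μ ⟨_⟩) fixed ⟨
    μ ⟨ ε ⟨ t ⟩ ⟩   ≡⟨ ∘ₛ-⟨⟩ μ ε t ⟨
    (μ ∘ₛ ε) ⟨ t ⟩  ∎

IsMgu-swap : ∀ {μ} {s t : Term Sg} {Γ} → IsMgu μ ((s , t) ∷ Γ) → IsMgu μ ((t , s) ∷ Γ)
IsMgu-swap (p ∷ u , general) = (sym p ∷ u) , λ { τ (q ∷ v) → general τ (sym q ∷ v) }

-- The recursion is on a bound for the weight of Γ under one fixed unifier θ,
-- which every transformation of Γ decreases, variable elimination included.
mgu-below : ∀ n (θ : Substitution Sg) Γ → Unifies θ Γ → weight θ Γ < n → ∃[ μ ] IsMgu μ Γ
mgu-below-var : ∀ n (θ : Substitution Sg) x t Γ → fun θ x ≡ θ ⟨ t ⟩ → Unifies θ Γ →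
                ∣ fun θ x ∣ + weight θ Γ < suc n → ∃[ μ ] IsMgu μ ((var x , t) ∷ Γ)

mgu-below (suc n) θ [] u w = idₛ , [] , λ τ _ → τ , λ _ → refl
mgu-below (suc n) θ ((var x , t) ∷ Γ) (p ∷ u) w = mgu-below-var n θ x t Γ p u w
mgu-below (suc n) θ ((t@(op _ _) , var x) ∷ Γ) (p ∷ u) w =
  let μ , isMgu =
        mgu-below-var n θ x t Γ (sym p) u (subst (λ s → ∣ s ∣ + weight θ Γ < suc n) p w)
  in μ , IsMgu-swap {μ = μ} isMgu
mgu-below (suc n) θ ((op g ss , op h ts) ∷ Γ) (p ∷ u) (s≤s w) with op-injective-symbol p
... | refl =
  let μ , v , general = mgu-below n θ (equate ss ts Γ) (equate⁺ θ ss ts (op-injective p) u)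
                          (subst (_< n) (sym (weight-equate θ ss ts)) w)
      q , v′ = equate⁻ μ ss ts v
  in μ , (cong (op g) q ∷ v′) , λ { τ (r ∷ v) → general τ (equate⁺ τ ss ts (op-injective r) v) }

mgu-below-var n θ x t Γ p u (s≤s w) with fixes-or-grows x t
... | inj₁ refl =
  let μ , v , general = mgu-below n θ Γ u (ℕ.<-≤-trans (ℕ.+-monoˡ-≤ _ 0<∣ fun θ x ∣) w)
  in μ , (refl ∷ v) , λ { τ (_ ∷ v) → general τ v }
-- Excluded, since `θ` gives both sides the same size.
... | inj₂ (inj₂ grows) = contradiction (cong ∣_∣ p) (ℕ.<⇒≢ (grows θ))
... | inj₂ (inj₁ fixed) =
  let μ , isMgu = mgu-below n θ (ε ⟨ Γ ⟩ₚ)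
        (Unifies-∘⁻ θ ε Γ (Unifies-resp-≐ {σ = θ} {τ = θ ∘ₛ ε} (sym ∘ absorbs θ p) u))
        (subst (_< n) (sym (trans (weight-∘ θ ε Γ) (weight-cong {σ = θ ∘ₛ ε} {τ = θ} (absorbs θ p) Γ)))
          (ℕ.<-≤-trans (ℕ.+-monoˡ-≤ _ 0<∣ fun θ x ∣) w))
  in μ ∘ₛ ε , eliminate {μ = μ} {Γ = Γ} (fixed t) isMgu
  where ε = idₛ [ x ↦ t ]

mgu : ∀ (θ : Substitution Sg) Γ → Unifies θ Γ → ∃[ μ ] IsMgu μ Γ
mgu θ Γ u = mgu-below _ θ Γ u (ℕ.n<1+n _)

-- The empty theory

≡-algebra : {B : Set} → ((g : Symbol Sg) → Vec B (arity Sg g) → B) → Algebra Sg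
≡-algebra {B = B} J = record
  { setoid      = ≡.setoid B
  ; interp      = J
  ; interp-cong = λ g eqs → cong (J g) (Pointwise-≡⇒≡ eqs)
  }

⊑⇒MoreGeneral : ∀ {E : Theory Sg} {X} (μ τ : Substitution Sg) → μ ⊑ τ → MoreGeneral E X μ τ
⊑⇒MoreGeneral μ τ (δ , eq) = δ , λ x _ → ≡⇒⊢ (eq x)

-- The term algebra with syntactic equality is a model, and evaluation at `var` returns the term
-- itself.
∅⊢⇒≡ : ∀ {s t : Term Sg} → ∅ ⊢ s ≈ t → s ≡ t
∅⊢⇒≡ {s = s} {t} p =
  trans (sym (extend-var s)) (trans (p (≡-algebra op) (λ ()) var) (extend-var t))

IsUnifier-∅⇒Unifies : ∀ (θ : Substitution Sg) {Γ} → IsUnifier ∅ Γ θ → Unifies θ Γ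
IsUnifier-∅⇒Unifies θ = All.map λ {(s , t)} → ∅⊢⇒≡ {s = θ ⟨ s ⟩} {θ ⟨ t ⟩}

coincide-∅ : (Sg : Signature) → TypesCoincide {Sg} ∅
coincide-∅ Sg = unitary
  , (([] , (idₛ , []) , type) , worst)
  , (([] , (idₛ , []) , type) , worst)
  where
  complete : ∀ {μ Γ} → IsMgu μ Γ → IsComplete {E = ∅} {Γ} {Fin 1} U (λ _ → μ)
  complete {μ} (u , general) = record
    { unifiers = λ _ → All.map ≡⇒⊢ u
    ; complete = λ θ v → zero , ⊑⇒MoreGeneral μ θ (general θ (IsUnifier-∅⇒Unifies θ v))
    }

  worst : ∀ {X : Problem Sg → Pred Var 0ℓ} Γ → Solvable ∅ Γ →
          ∀ τ → HasType ∅ Γ (X Γ) τ → τ ≤ᵗ unitary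
  worst Γ (θ , u) =
    let μ , isMgu = mgu θ Γ (IsUnifier-∅⇒Unifies θ u)
    in mgu⇒type≤unitary (complete {μ} isMgu)

  type : ∀ {X} → HasType ∅ [] X unitary
  type {X} = _ , mc , cardinality c irr mc
    where
    c : IsComplete {Γ = []} X (λ (_ : Fin 1) → idₛ)
    c = IsComplete-antimono (λ _ → _) (complete ([] , λ τ _ → τ , λ _ → refl))

    irr : Irredundant {E = ∅} {Γ = []} X (λ (_ : Fin 1) → idₛ)
    irr zero zero _ = refl

    mc = range-isMinimalComplete c λ _ _ _ _ → refl

-- Reduction of C and I to syntactic unification

-- Solvability is split on under a double negation instead of being decided: a solvable problem
-- contributes its most general unifier, an unsolvable one nothing.
¬¬-mgus : ∀ {Sg} (Γs : List (Problem Sg)) →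
          ¬ ¬ (∃[ μs ] All (λ μ → Any (Unifies μ) Γs) μs ×
                       (∀ θ → Any (Unifies θ) Γs → Any (_⊑ θ) μs))
¬¬-mgus []       k = k ([] , [] , λ _ ())
¬¬-mgus (Γ ∷ Γs) k = ¬¬-mgus Γs λ (μs , sound , complete) →
  ¬¬-excluded-middle {A = ∃[ θ ] Unifies θ Γ} λ where
  (yes (θ , u)) → let μ , v , general = mgu θ Γ u in
    k (μ ∷ μs , here v ∷ All.map there sound , λ where
      θ (here w)  → here (general θ w)
      θ (there w) → there (complete θ w))
  (no unsolvable) → k (μs , All.map there sound , λ where
      θ (here w)  → contradiction (θ , w) unsolvable
      θ (there w) → complete θ w)

binaryOp : {B : Set} → (B → B → B) → (g : Symbol binary) → Vec B (arity binary g) → B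
binaryOp _∙_ zero (a ∷ b ∷ []) = a ∙ b

⊢-f : ∀ (E : Theory binary) {s s′ t t′} → E ⊢ s ≈ s′ → E ⊢ t ≈ t′ → E ⊢ f s t ≈ f s′ t′
⊢-f E p q M m ρ = Algebra.interp-cong M zero (p M m ρ ∷ q M m ρ ∷ [])

-- a ⋆ b is a normal form of f a b for normal forms a and b. It is either f a b
-- itself, or an instance of the alternative, in which case the instance solves
-- the equations attached to the alternative.
module Variants
  (E : Theory binary) (_⋆_ : Term binary → Term binary → Term binary)
  (model : ≡-algebra (binaryOp _⋆_) ⊨ᵗ E)
  (⋆-sound : ∀ a b → E ⊢ a ⋆ b ≈ f a b)
  (alt : Term binary → Term binary → Term binary × Problem binary)
  (alt-sound : ∀ σ s t → Unifies σ (proj₂ (alt s t)) →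
               E ⊢ f (σ ⟨ s ⟩) (σ ⟨ t ⟩) ≈ σ ⟨ proj₁ (alt s t) ⟩)
  (⋆-cases : ∀ σ s t → (σ ⟨ s ⟩) ⋆ (σ ⟨ t ⟩) ≡ f (σ ⟨ s ⟩) (σ ⟨ t ⟩) ⊎
             (σ ⟨ s ⟩) ⋆ (σ ⟨ t ⟩) ≡ σ ⟨ proj₁ (alt s t) ⟩ × Unifies σ (proj₂ (alt s t)))
  where

  eval : (Var → Term binary) → Term binary → Term binary
  eval = extend (binaryOp _⋆_)

  nf : Term binary → Term binary
  nf = eval var

  nf-sound : ∀ t → E ⊢ nf t ≈ t
  nf-sound (var x)                = ≡⇒⊢ {s = var x} refl
  nf-sound (op zero (s ∷ t ∷ [])) =
    ⊢-trans {s = nf s ⋆ nf t} {f (nf s) (nf t)} {f s t} (⋆-sound (nf s) (nf t))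
      (⊢-f E {s = nf s} {s} {nf t} {t} (nf-sound s) (nf-sound t))

  nf-cong : ∀ {s t} → E ⊢ s ≈ t → nf s ≡ nf t
  nf-cong p = p (≡-algebra (binaryOp _⋆_)) model var

  -- Serves to refute comparisons: an instance of one term cannot equal, modulo `E`, two terms with
  -- different normal forms.
  same-image : ∀ {s t u} → E ⊢ s ≈ t → E ⊢ s ≈ u → nf t ≡ nf u
  same-image {s} {t} {u} p q = trans (sym (nf-cong {s} {t} p)) (nf-cong {s} {u} q)

  nfₛ : Substitution binary → Substitution binary
  nfₛ θ = record
    { fun          = nf ∘ fun θ
    ; finiteDomain = proj₁ (finiteDomain θ) , λ x ne → proj₂ (finiteDomain θ) x (ne ∘ cong nf)
    }

  nf-⟨⟩ : ∀ θ t → nf (θ ⟨ t ⟩) ≡ eval (fun (nfₛ θ)) t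
  nf-⟨⟩ θ t = extend-∘ (binaryOp _⋆_) var (fun θ) t

  -- Normalising a unifier does not change it modulo `E`, so syntactic generality over normalised
  -- unifiers is enough.
  ⊑-nfₛ⇒MoreGeneral : ∀ {X} μ θ → μ ⊑ nfₛ θ → MoreGeneral E X μ θ
  ⊑-nfₛ⇒MoreGeneral μ θ (δ , eq) = δ , λ x _ →
    ⊢-trans {s = δ ⟨ fun μ x ⟩} {nf (fun θ x)} {fun θ x} (≡⇒⊢ (eq x)) (nf-sound (fun θ x))

  Variant : Set
  Variant = Term binary × Problem binary

  keep switch : Variant → Variant → Variant
  keep   (s , Δ) (t , Δ′) = f s t , Δ ++ Δ′
  switch (s , Δ) (t , Δ′) = proj₁ (alt s t) , proj₂ (alt s t) ++ Δ ++ Δ′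

  -- One entry for each way of choosing between `keep` and `switch` at every node. The second
  -- component collects the equations under which the choices are legitimate.
  variants : Term binary → List Variant
  variants (var x)                = [ var x , [] ]
  variants (op zero (s ∷ t ∷ [])) =
    cartesianProductWith keep (variants s) (variants t) ++
    cartesianProductWith switch (variants s) (variants t)

  variant-sound : ∀ σ t {t′ Δ} → (t′ , Δ) ∈ variants t → Unifies σ Δ → E ⊢ σ ⟨ t ⟩ ≈ σ ⟨ t′ ⟩
  variant-sound σ (var x) (here refl) u = ≡⇒⊢ {s = fun σ x} refl
  variant-sound σ (op zero (s ∷ t ∷ [])) v∈ u with ∈-++⁻ _ v∈
  ... | inj₁ v∈keep with (s′ , Δ) , (t′ , Δ′) , s∈ , t∈ , refl ←
                         ∈-cartesianProductWith⁻ keep (variants s) (variants t) v∈keep =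
    ⊢-f E {s = σ ⟨ s ⟩} {σ ⟨ s′ ⟩} {σ ⟨ t ⟩} {σ ⟨ t′ ⟩}
      (variant-sound σ s s∈ (All.++⁻ˡ Δ u)) (variant-sound σ t t∈ (All.++⁻ʳ Δ u))
  ... | inj₂ v∈switch with (s′ , Δ) , (t′ , Δ′) , s∈ , t∈ , refl ←
                           ∈-cartesianProductWith⁻ switch (variants s) (variants t) v∈switch =
    let u₁ , u₂ = All.++⁻ (proj₂ (alt s′ t′)) u in
    ⊢-trans {s = f (σ ⟨ s ⟩) (σ ⟨ t ⟩)} {f (σ ⟨ s′ ⟩) (σ ⟨ t′ ⟩)} {σ ⟨ proj₁ (alt s′ t′) ⟩}
      (⊢-f E {s = σ ⟨ s ⟩} {σ ⟨ s′ ⟩} {σ ⟨ t ⟩} {σ ⟨ t′ ⟩}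
        (variant-sound σ s s∈ (All.++⁻ˡ Δ u₂)) (variant-sound σ t t∈ (All.++⁻ʳ Δ u₂)))
      (alt-sound σ s′ t′ u₁)

  -- By induction the arguments evaluate to instances of variants, so `⋆-cases` applies at the node
  -- and selects `keep` or `switch`.
  variant-complete : ∀ σ t → ∃₂ λ t′ Δ →
                     (t′ , Δ) ∈ variants t × eval (fun σ) t ≡ σ ⟨ t′ ⟩ × Unifies σ Δ
  variant-complete σ (var x) = var x , [] , here refl , refl , []
  variant-complete σ (op zero (s ∷ t ∷ []))
    with s′ , Δ , s∈ , p , u ← variant-complete σ s
       | t′ , Δ′ , t∈ , q , v ← variant-complete σ t
    with ⋆-cases σ s′ t′
  ... | inj₁ kept = _ , _ , ∈-++⁺ˡ (∈-cartesianProductWith⁺ keep s∈ t∈)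
                  , trans (cong₂ _⋆_ p q) kept , All.++⁺ u v
  ... | inj₂ (switched , w) = _ , _
                  , ∈-++⁺ʳ _ (∈-cartesianProductWith⁺ switch s∈ t∈)
                  , trans (cong₂ _⋆_ p q) switched , All.++⁺ w (All.++⁺ u v)

  require : Variant × Variant → Problem binary → Problem binary
  require ((s , Δ) , (t , Δ′)) Γ = (s , t) ∷ Δ ++ Δ′ ++ Γ

  variantsₚ : Problem binary → List (Problem binary)
  variantsₚ []            = [ [] ]
  variantsₚ ((s , t) ∷ Γ) =
    cartesianProductWith require (cartesianProduct (variants s) (variants t)) (variantsₚ Γ)

  variantsₚ-sound : ∀ σ Γ {Γ′} → Γ′ ∈ variantsₚ Γ → Unifies σ Γ′ → IsUnifier E Γ σ
  variantsₚ-sound σ []            _  _ = []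
  variantsₚ-sound σ ((s , t) ∷ Γ) Γ∈ u
    with ((s′ , Δ) , (t′ , Δ′)) , Γ′ , st∈ , Γ′∈ , refl ←
           ∈-cartesianProductWith⁻ require (cartesianProduct (variants s) (variants t)) (variantsₚ Γ) Γ∈
    with s∈ , t∈ ← ∈-cartesianProduct⁻ (variants s) (variants t) st∈
    with p ∷ v ← u =
    (begin
      σ ⟨ s ⟩   ≈⟨ variant-sound σ s s∈ (All.++⁻ˡ Δ v) ⟩
      σ ⟨ s′ ⟩  ≡⟨ p ⟩
      σ ⟨ t′ ⟩  ≈⟨ variant-sound σ t t∈ (All.++⁻ˡ Δ′ (All.++⁻ʳ Δ v)) ⟨
      σ ⟨ t ⟩   ∎)
    ∷ variantsₚ-sound σ Γ Γ′∈ (All.++⁻ʳ Δ′ (All.++⁻ʳ Δ v))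
    where open import Relation.Binary.Reasoning.Setoid (⊢-setoid E)

  -- Sides equal modulo `E` have the same normal form. By `nf-⟨⟩` it is their evaluation under
  -- `nfₛ θ`, and this is an instance of a variant; hence `nfₛ θ` rather than `θ` in the conclusion.
  variantsₚ-complete : ∀ θ Γ → IsUnifier E Γ θ → ∃[ Γ′ ] Γ′ ∈ variantsₚ Γ × Unifies (nfₛ θ) Γ′
  variantsₚ-complete θ [] _ = [] , here refl , []
  variantsₚ-complete θ ((s , t) ∷ Γ) (p ∷ u)
    with s′ , Δ , s∈ , q , v ← variant-complete (nfₛ θ) s
       | t′ , Δ′ , t∈ , r , w ← variant-complete (nfₛ θ) t
       | Γ′ , Γ′∈ , u′ ← variantsₚ-complete θ Γ u =
      _ , ∈-cartesianProductWith⁺ require (∈-cartesianProduct⁺ s∈ t∈) Γ′∈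
    , (begin
        nfₛ θ ⟨ s′ ⟩          ≡⟨ q ⟨
        eval (fun (nfₛ θ)) s  ≡⟨ nf-⟨⟩ θ s ⟨
        nf (θ ⟨ s ⟩)          ≡⟨ nf-cong {θ ⟨ s ⟩} {θ ⟨ t ⟩} p ⟩
        nf (θ ⟨ t ⟩)          ≡⟨ nf-⟨⟩ θ t ⟩
        eval (fun (nfₛ θ)) t  ≡⟨ r ⟩
        nfₛ θ ⟨ t′ ⟩          ∎)
      ∷ All.++⁺ v (All.++⁺ w u′)
    where open ≡-Reasoning

  -- The family consists of the most general unifiers of the variants of `Γ`. The normalised form of
  -- any unifier solves some variant syntactically and so is an instance of a member.
  finitelyComplete : ∀ Γ → ¬ ¬ FinitelyComplete {E = E} Γ
  finitelyComplete Γ k = ¬¬-mgus (variantsₚ Γ) λ (μs , sound , complete) →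
    k (length μs , lookup μs , record
      { unifiers = λ i →
          let Γ′ , Γ′∈ , u = find (All.lookup sound (∈-lookup i))
          in variantsₚ-sound (lookup μs i) Γ Γ′∈ u
      ; complete = λ θ u →
          let Γ′ , Γ′∈ , v = variantsₚ-complete θ Γ u
              μ∈ = complete (nfₛ θ) (lose Γ′∈ v)
          in index μ∈ , ⊑-nfₛ⇒MoreGeneral (lookup μs (index μ∈)) θ (lookup-index μ∈)
      })

  coincide : ∀ {Γ n} {fam : Fin n → Substitution binary} → n > 1 →
             IsComplete {E = E} {Γ} U fam → Irredundant {E = E} {Γ} (VarOf Γ) fam → TypesCoincide E
  coincide {Γ} {fam = fam} n>1@(s≤s _) c irr =
    let restricted , unrestricted = finitary-example {E = E} {fam = fam} n>1 c irr in
      finitary , ((Γ , solvable , restricted) , worst) , ((Γ , solvable , unrestricted) , worst)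
    where
    solvable : Solvable E Γ
    solvable = fam zero , IsComplete.unifiers c zero

    worst : ∀ {X : Problem binary → Pred Var 0ℓ} Γ → Solvable E Γ →
            ∀ τ → HasType E Γ (X Γ) τ → τ ≤ᵗ finitary
    worst Γ _ = type≤finitary (finitelyComplete Γ)

-- x, y, z and w are the variables 0, 1, 2 and 3.
fxy≈fzw : Problem binary
fxy≈fzw = [ f (var 0) (var 1) , f (var 2) (var 3) ]

pattern x∈ = here (inj₁ (there (VecAny.here here)))
pattern y∈ = here (inj₁ (there (VecAny.there (VecAny.here here))))
pattern z∈ = here (inj₂ (there (VecAny.here here)))
pattern w∈ = here (inj₂ (there (VecAny.there (VecAny.here here))))

decomposing : Substitution binary
decomposing = idₛ [ 0 ↦ var 2 ] [ 1 ↦ var 3 ]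

-- Commutativity

-- This is 2^m (2n + 1).
pair : ℕ → ℕ → ℕ
pair zero    n = suc (2 * n)
pair (suc m) n = 2 * pair m n

pair-injective : ∀ m n m′ n′ → pair m n ≡ pair m′ n′ → m ≡ m′ × n ≡ n′
pair-injective zero    n zero     n′ eq = refl , ℕ.*-cancelˡ-≡ n n′ 2 (ℕ.suc-injective eq)
pair-injective zero    n (suc m′) n′ eq = contradiction (sym eq) (ℕ.even≢odd (pair m′ n′) n)
pair-injective (suc m) n zero     n′ eq = contradiction eq (ℕ.even≢odd (pair m n) n′)
pair-injective (suc m) n (suc m′) n′ eq =
  let p , q = pair-injective m n m′ n′ (ℕ.*-cancelˡ-≡ (pair m n) (pair m′ n′) 2 eq)
  in cong suc p , q

-- A Gödel numbering, with exponent zero for variables and a positive one for applications. It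
-- supplies the linear order by which `⋆` sorts its arguments.
code : Term binary → ℕ
code (var x)                = pair 0 x
code (op zero (s ∷ t ∷ [])) = pair (suc (code s)) (code t)

code-injective : ∀ s t → code s ≡ code t → s ≡ t
code-injective (var x) (var y) eq = cong var (proj₂ (pair-injective 0 x 0 y eq))
code-injective (var x) (op zero (s ∷ t ∷ [])) eq
  with () ← proj₁ (pair-injective 0 x (suc (code s)) (code t) eq)
code-injective (op zero (s ∷ t ∷ [])) (var x) eq
  with () ← proj₁ (pair-injective (suc (code s)) (code t) 0 x eq)
code-injective (op zero (s ∷ t ∷ [])) (op zero (s′ ∷ t′ ∷ [])) eq =
  let p , q = pair-injective (suc (code s)) (code t) (suc (code s′)) (code t′) eq
  in cong₂ f (code-injective s s′ (ℕ.suc-injective p)) (code-injective t t′ q)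

module Commutative where

  _⋆_ : Term binary → Term binary → Term binary
  a ⋆ b with code a ≤? code b
  ... | yes _ = f a b
  ... | no  _ = f b a

  ⋆-either : ∀ a b → a ⋆ b ≡ f a b ⊎ a ⋆ b ≡ f b a
  ⋆-either a b with code a ≤? code b
  ... | yes _ = inj₁ refl
  ... | no  _ = inj₂ refl

  ⋆-comm : ∀ a b → a ⋆ b ≡ b ⋆ a
  ⋆-comm a b with code a ≤? code b | code b ≤? code a
  ... | no  _   | yes _   = refl
  ... | yes _   | no  _   = refl
  ... | yes a≤b | yes b≤a = let a≡b = code-injective a b (ℕ.≤-antisym a≤b b≤a) in
                            cong₂ f a≡b (sym a≡b)
  ... | no  a≰b | no  b≰a = contradiction (ℕ.≰⇒≥ a≰b) b≰a

  comm : ∀ s t → C ⊢ f s t ≈ f t s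
  comm s t M m ρ = m refl λ where
    0 → extend (Algebra.interp M) ρ s
    _ → extend (Algebra.interp M) ρ t

  ⋆-sound : ∀ a b → C ⊢ a ⋆ b ≈ f a b
  ⋆-sound a b with code a ≤? code b
  ... | yes _ = ≡⇒⊢ {s = f a b} refl
  ... | no  _ = comm b a

  model : ≡-algebra (binaryOp _⋆_) ⊨ᵗ C
  model refl ρ = ⋆-comm (ρ 0) (ρ 1)

  swapped : Term binary → Term binary → Term binary × Problem binary
  swapped s t = f t s , []

  swapped-sound : ∀ σ s t → Unifies σ (proj₂ (swapped s t)) →
                  C ⊢ f (σ ⟨ s ⟩) (σ ⟨ t ⟩) ≈ σ ⟨ proj₁ (swapped s t) ⟩
  swapped-sound σ s t _ = comm (σ ⟨ s ⟩) (σ ⟨ t ⟩)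

  ⋆-cases : ∀ σ s t → (σ ⟨ s ⟩) ⋆ (σ ⟨ t ⟩) ≡ f (σ ⟨ s ⟩) (σ ⟨ t ⟩) ⊎
            (σ ⟨ s ⟩) ⋆ (σ ⟨ t ⟩) ≡ σ ⟨ proj₁ (swapped s t) ⟩ × Unifies σ (proj₂ (swapped s t))
  ⋆-cases σ s t = Sum.map₂ (_, []) (⋆-either (σ ⟨ s ⟩) (σ ⟨ t ⟩))

  open Variants C _⋆_ model ⋆-sound swapped swapped-sound ⋆-cases

  ⋆-decompose : ∀ a b c d → a ⋆ b ≡ c ⋆ d → a ≡ c × b ≡ d ⊎ a ≡ d × b ≡ c
  ⋆-decompose a b c d eq with code a ≤? code b | code c ≤? code d
  ⋆-decompose a b c d refl | yes _ | yes _ = inj₁ (refl , refl)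
  ⋆-decompose a b c d refl | yes _ | no _  = inj₂ (refl , refl)
  ⋆-decompose a b c d refl | no _  | yes _ = inj₂ (refl , refl)
  ⋆-decompose a b c d refl | no _  | no _  = inj₁ (refl , refl)

  solution : Fin 2 → Substitution binary
  solution zero       = decomposing
  solution (suc zero) = idₛ [ 0 ↦ var 3 ] [ 1 ↦ var 2 ]

  solution-complete : IsComplete {E = C} {fxy≈fzw} U solution
  solution-complete = record
    { unifiers = λ where
        zero       → ≡⇒⊢ {s = f (var 2) (var 3)} refl ∷ []
        (suc zero) → comm (var 3) (var 2) ∷ []
    ; complete = λ { θ (p ∷ []) → complete θ (⋆-decompose _ _ _ _ (nf-equal θ p)) }
    }
    where
    nf-equal : ∀ θ → C ⊢ θ ⟨ f (var 0) (var 1) ⟩ ≈ θ ⟨ f (var 2) (var 3) ⟩ →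
               nf (fun θ 0) ⋆ nf (fun θ 1) ≡ nf (fun θ 2) ⋆ nf (fun θ 3)
    nf-equal θ p = nf-cong {θ ⟨ f (var 0) (var 1) ⟩} {θ ⟨ f (var 2) (var 3) ⟩} p

    complete : ∀ θ → let a = nf (fun θ 0); b = nf (fun θ 1); c = nf (fun θ 2); d = nf (fun θ 3) in
               a ≡ c × b ≡ d ⊎ a ≡ d × b ≡ c → ∃[ i ] MoreGeneral C U (solution i) θ
    -- `nfₛ θ` itself instantiates the solution: by the two equations it absorbs the eliminations.
    complete θ (inj₁ (a≡c , b≡d)) = zero , ⊑-nfₛ⇒MoreGeneral (solution zero) θ (nfₛ θ , λ where
      0 → sym a≡c
      1 → sym b≡d
      (suc (suc _)) → refl)
    complete θ (inj₂ (a≡d , b≡c)) = suc zero , ⊑-nfₛ⇒MoreGeneral (solution (suc zero)) θ (nfₛ θ , λ where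
      0 → sym a≡d
      1 → sym b≡c
      (suc (suc _)) → refl)

  -- One solution identifies `x` with `z`, the other `x` with `w`. Instances preserve
  -- identifications, and each solution keeps apart the pair identified by the other.
  irredundant-solution : Irredundant {E = C} {fxy≈fzw} (VarOf fxy≈fzw) solution
  irredundant-solution zero       zero       _       = refl
  irredundant-solution (suc zero) (suc zero) _       = refl
  irredundant-solution zero       (suc zero) (δ , p)
    with () ← same-image {δ ⟨ var 2 ⟩} {var 3} {var 2} (p 0 x∈) (p 2 z∈)
  irredundant-solution (suc zero) zero       (δ , p)
    with () ← same-image {δ ⟨ var 3 ⟩} {var 2} {var 3} (p 0 x∈) (p 3 w∈)

  coincide-C : TypesCoincide C
  coincide-C = coincide {fam = solution} (s≤s (s≤s z≤n)) solution-complete irredundant-solution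

-- Idempotency

module Idempotent where

  _⋆_ : Term binary → Term binary → Term binary
  a ⋆ b with a ≟ b
  ... | yes _ = a
  ... | no  _ = f a b

  ⋆-idem : ∀ a → a ⋆ a ≡ a
  ⋆-idem a with a ≟ a
  ... | yes _  = refl
  ... | no a≢a = contradiction refl a≢a

  idem : ∀ s → I ⊢ f s s ≈ s
  idem s M m ρ = m refl λ _ → extend (Algebra.interp M) ρ s

  idem-≡ : ∀ s t → s ≡ t → I ⊢ f s t ≈ s
  idem-≡ s .s refl = idem s

  ⋆-sound : ∀ a b → I ⊢ a ⋆ b ≈ f a b
  ⋆-sound a b with a ≟ b
  ... | yes a≡b = ⊢-sym {s = f a b} {a} (idem-≡ a b a≡b)
  ... | no  _   = ≡⇒⊢ {s = f a b} refl

  ⋆-either : ∀ a b → a ⋆ b ≡ f a b ⊎ a ⋆ b ≡ a × a ≡ b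
  ⋆-either a b with a ≟ b
  ... | yes a≡b = inj₂ (refl , a≡b)
  ... | no  _   = inj₁ refl

  model : ≡-algebra (binaryOp _⋆_) ⊨ᵗ I
  model refl ρ = ⋆-idem (ρ 0)

  collapsed : Term binary → Term binary → Term binary × Problem binary
  collapsed s t = s , [ s , t ]

  collapsed-sound : ∀ σ s t → Unifies σ (proj₂ (collapsed s t)) →
                    I ⊢ f (σ ⟨ s ⟩) (σ ⟨ t ⟩) ≈ σ ⟨ proj₁ (collapsed s t) ⟩
  collapsed-sound σ s t (p ∷ []) = idem-≡ (σ ⟨ s ⟩) (σ ⟨ t ⟩) p

  ⋆-cases : ∀ σ s t → (σ ⟨ s ⟩) ⋆ (σ ⟨ t ⟩) ≡ f (σ ⟨ s ⟩) (σ ⟨ t ⟩) ⊎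
            (σ ⟨ s ⟩) ⋆ (σ ⟨ t ⟩) ≡ σ ⟨ proj₁ (collapsed s t) ⟩ × Unifies σ (proj₂ (collapsed s t))
  ⋆-cases σ s t = Sum.map₂ (Product.map₂ (_∷ [])) (⋆-either (σ ⟨ s ⟩) (σ ⟨ t ⟩))

  open Variants I _⋆_ model ⋆-sound collapsed collapsed-sound ⋆-cases

  ⋆-decompose : ∀ a b c d → a ⋆ b ≡ c ⋆ d →
                (a ≡ c × b ≡ d) ⊎ (a ≡ f c d × b ≡ f c d) ⊎ (c ≡ f a b × d ≡ f a b)
  ⋆-decompose a b c d eq with ⋆-either a b | ⋆-either c d
  ... | inj₁ p | inj₁ q with refl ← trans (sym p) (trans eq q) = inj₁ (refl , refl)
  ... | inj₂ (p , refl) | inj₁ q =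
    let a≡fcd = trans (sym p) (trans eq q) in inj₂ (inj₁ (a≡fcd , a≡fcd))
  ... | inj₁ p | inj₂ (q , refl) =
    let c≡fab = trans (sym q) (trans (sym eq) p) in inj₂ (inj₂ (c≡fab , c≡fab))
  -- When both products collapse, all four arguments agree, which is an instance of the first case.
  ... | inj₂ (p , refl) | inj₂ (q , refl) =
    let a≡c = trans (sym p) (trans eq q) in inj₁ (a≡c , a≡c)

  solution : Fin 3 → Substitution binary
  solution zero             = decomposing
  solution (suc zero)       = idₛ [ 0 ↦ f (var 2) (var 3) ] [ 1 ↦ f (var 2) (var 3) ]
  solution (suc (suc zero)) = idₛ [ 2 ↦ f (var 0) (var 1) ] [ 3 ↦ f (var 0) (var 1) ]

  solution-complete : IsComplete {E = I} {fxy≈fzw} U solution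
  solution-complete = record
    { unifiers = λ where
        zero             → ≡⇒⊢ {s = f (var 2) (var 3)} refl ∷ []
        (suc zero)       → idem (f (var 2) (var 3)) ∷ []
        (suc (suc zero)) → ⊢-sym {s = f (f (var 0) (var 1)) (f (var 0) (var 1))} {f (var 0) (var 1)}
                             (idem (f (var 0) (var 1))) ∷ []
    ; complete = λ { θ (p ∷ []) → complete θ (⋆-decompose _ _ _ _
        (nf-cong {θ ⟨ f (var 0) (var 1) ⟩} {θ ⟨ f (var 2) (var 3) ⟩} p)) }
    }
    where
    complete : ∀ θ → let a = nf (fun θ 0); b = nf (fun θ 1); c = nf (fun θ 2); d = nf (fun θ 3) in
               (a ≡ c × b ≡ d) ⊎ (a ≡ f c d × b ≡ f c d) ⊎ (c ≡ f a b × d ≡ f a b) →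
               ∃[ i ] MoreGeneral I U (solution i) θ
    complete θ (inj₁ (a≡c , b≡d)) =
      zero , ⊑-nfₛ⇒MoreGeneral (solution zero) θ (nfₛ θ , λ where
        0             → sym a≡c
        1             → sym b≡d
        (suc (suc _)) → refl)
    complete θ (inj₂ (inj₁ (a≡fcd , b≡fcd))) =
      suc zero , ⊑-nfₛ⇒MoreGeneral (solution (suc zero)) θ (nfₛ θ , λ where
        0             → sym a≡fcd
        1             → sym b≡fcd
        (suc (suc _)) → refl)
    complete θ (inj₂ (inj₂ (c≡fab , d≡fab))) =
      suc (suc zero) , ⊑-nfₛ⇒MoreGeneral (solution (suc (suc zero))) θ (nfₛ θ , λ where
        0                         → refl
        1                         → refl
        2                         → sym c≡fab
        3                         → sym d≡fab
        (suc (suc (suc (suc _)))) → refl)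

  -- The solutions identify `x` with `z`, `x` with `y`, and `z` with `w`, respectively. Each of
  -- these pairs is kept apart by the other two solutions, whereas an instance would preserve its
  -- identification.
  irredundant-solution : Irredundant {E = I} {fxy≈fzw} (VarOf fxy≈fzw) solution
  irredundant-solution zero             zero             _ = refl
  irredundant-solution (suc zero)       (suc zero)       _ = refl
  irredundant-solution (suc (suc zero)) (suc (suc zero)) _ = refl
  irredundant-solution zero (suc zero) (δ , p)
    with () ← same-image {δ ⟨ var 2 ⟩} {f (var 2) (var 3)} {var 2} (p 0 x∈) (p 2 z∈)
  irredundant-solution zero (suc (suc zero)) (δ , p)
    with () ← same-image {δ ⟨ var 2 ⟩} {var 0} {f (var 0) (var 1)} (p 0 x∈) (p 2 z∈)
  irredundant-solution (suc zero) zero (δ , p)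
    with () ← same-image {δ ⟨ f (var 2) (var 3) ⟩} {var 2} {var 3} (p 0 x∈) (p 1 y∈)
  irredundant-solution (suc zero) (suc (suc zero)) (δ , p)
    with () ← same-image {δ ⟨ f (var 2) (var 3) ⟩} {var 0} {var 1} (p 0 x∈) (p 1 y∈)
  irredundant-solution (suc (suc zero)) zero (δ , p)
    with () ← same-image {δ ⟨ f (var 0) (var 1) ⟩} {var 2} {var 3} (p 2 z∈) (p 3 w∈)
  irredundant-solution (suc (suc zero)) (suc zero) (δ , p)
    with () ← same-image {δ ⟨ f (var 0) (var 1) ⟩} {var 2} {var 3} (p 2 z∈) (p 3 w∈)

  coincide-I : TypesCoincide I
  coincide-I = coincide {fam = solution} (s≤s (s≤s z≤n)) solution-complete irredundant-solution

-- Words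

appendOp : (g : Symbol binary) → Vec (List Var) (arity binary g) → List Var
appendOp = binaryOp _++_

word : Term binary → List Var
word = extend appendOp [_]

letters : Substitution binary → Var → List Var
letters σ x = word (fun σ x)

extend-word : ∀ g t → extend appendOp g t ≡ concatMap g (word t)
extend-word g (var x)                = sym (List.++-identityʳ (g x))
extend-word g (op zero (s ∷ t ∷ [])) =
  trans (cong₂ _++_ (extend-word g s) (extend-word g t)) (sym (List.concatMap-++ g (word s) (word t)))

word-⟨⟩ : ∀ σ t → word (σ ⟨ t ⟩) ≡ concatMap (letters σ) (word t)
word-⟨⟩ σ t = trans (extend-∘ appendOp [_] (fun σ) t) (extend-word (letters σ) t)

concatMap-letters-∘ : ∀ σ τ u →
  concatMap (letters (σ ∘ₛ τ)) u ≡ concatMap (letters σ) (concatMap (letters τ) u)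
concatMap-letters-∘ σ τ []      = refl
concatMap-letters-∘ σ τ (x ∷ u) = trans
  (cong₂ _++_ (word-⟨⟩ σ (fun τ x)) (concatMap-letters-∘ σ τ u))
  (sym (List.concatMap-++ (letters σ) (letters τ x) _))

0<length-word : ∀ t → 0 < length (word t)
0<length-word (var x)                = s≤s z≤n
0<length-word (op zero (s ∷ t ∷ [])) = ℕ.<-≤-trans (0<length-word s)
  (ℕ.≤-trans (ℕ.m≤m+n _ _) (ℕ.≤-reflexive (sym (List.length-++ (word s)))))

letters-++≢[] : ∀ σ x u → letters σ x ++ u ≢ []
letters-++≢[] σ x u eq with letters σ x | 0<length-word (fun σ x)
letters-++≢[] σ x u () | _ ∷ _ | _

-- Words under concatenation are a model of `A`.
word-cong : ∀ {s t} → A ⊢ s ≈ t → word s ≡ word t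
word-cong p = p (≡-algebra appendOp)
  (λ { refl ρ → sym (List.++-assoc (ρ 0) (ρ 1) (ρ 2)) }) [_]

-- The empty word, which is not the word of a term, is sent to var 0.
term : List Var → Term binary
term []          = var 0
term (x ∷ [])    = var x
term (x ∷ y ∷ u) = f (var x) (term (y ∷ u))

word-term : ∀ x u → word (term (x ∷ u)) ≡ x ∷ u
word-term x []      = refl
word-term x (y ∷ u) = cong (x ∷_) (word-term y u)

assoc : ∀ s t u → A ⊢ f s (f t u) ≈ f (f s t) u
assoc s t u M m ρ = m refl λ where
  0 → extend (Algebra.interp M) ρ s
  1 → extend (Algebra.interp M) ρ t
  _ → extend (Algebra.interp M) ρ u

module A-Reasoning where
  open import Relation.Binary.Reasoning.Setoid (⊢-setoid A) public

term-++ : ∀ u v → 0 < length u → 0 < length v → A ⊢ f (term u) (term v) ≈ term (u ++ v)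
term-++ (x ∷ [])    v@(_ ∷ _) _ _ = ≡⇒⊢ {s = f (var x) (term v)} refl
term-++ (x ∷ y ∷ u) v@(_ ∷ _) _ _ = begin
  f (f (var x) (term (y ∷ u))) (term v)  ≈⟨ assoc (var x) (term (y ∷ u)) (term v) ⟨
  f (var x) (f (term (y ∷ u)) (term v))  ≈⟨ ⊢-f A {var x} {var x} {f (term (y ∷ u)) (term v)}
                                              {term (y ∷ u ++ v)} (≡⇒⊢ {s = var x} refl)
                                              (term-++ (y ∷ u) v (s≤s z≤n) (s≤s z≤n)) ⟩
  f (var x) (term (y ∷ u ++ v))          ∎
  where open A-Reasoning

term-word : ∀ t → A ⊢ t ≈ term (word t)
term-word (var x)                = ≡⇒⊢ {s = var x} refl
term-word (op zero (s ∷ t ∷ [])) = begin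
  f s t                              ≈⟨ ⊢-f A {s} {term (word s)} {t} {term (word t)}
                                          (term-word s) (term-word t) ⟩
  f (term (word s)) (term (word t))  ≈⟨ term-++ (word s) (word t)
                                          (0<length-word s) (0<length-word t) ⟩
  term (word s ++ word t)            ∎
  where open A-Reasoning

-- Modulo `A`, each term equals the right-nested product of the letters of its word.
word-injective : ∀ s t → word s ≡ word t → A ⊢ s ≈ t
word-injective s t eq = begin
  s              ≈⟨ term-word s ⟩
  term (word s)  ≡⟨ cong term eq ⟩
  term (word t)  ≈⟨ term-word t ⟨
  t              ∎
  where open A-Reasoning

WordProblem : Set
WordProblem = List (List Var × List Var)

words : Problem binary → WordProblem
words = map λ (s , t) → word s , word t

WordUnifies : (Var → List Var) → WordProblem → Set
WordUnifies g = All λ (u , v) → concatMap g u ≡ concatMap g v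

IsUnifier⇒WordUnifies : ∀ σ Γ → IsUnifier A Γ σ → WordUnifies (letters σ) (words Γ)
IsUnifier⇒WordUnifies σ Γ u = All.map⁺ (All.map (λ {(s , t)} p →
  trans (sym (word-⟨⟩ σ s)) (trans (word-cong {σ ⟨ s ⟩} {σ ⟨ t ⟩} p) (word-⟨⟩ σ t))) u)

WordUnifies⇒IsUnifier : ∀ σ Γ → WordUnifies (letters σ) (words Γ) → IsUnifier A Γ σ
WordUnifies⇒IsUnifier σ Γ u = All.map (λ {(s , t)} p → word-injective (σ ⟨ s ⟩) (σ ⟨ t ⟩)
  (trans (word-⟨⟩ σ s) (trans p (sym (word-⟨⟩ σ t))))) (All.map⁻ u)

-- Deterministic solution of word equations

-- How the value of x compares in length with that of y.
data Comparison : Set where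
  equal shorter longer : Comparison

Compares : Comparison → ℕ → ℕ → Set
Compares equal   m n = m ≡ n
Compares shorter m n = m < n
Compares longer  m n = n < m

Compares-unique : ∀ k k′ {m n} → Compares k m n → Compares k′ m n → k ≡ k′
Compares-unique equal   equal   _ _ = refl
Compares-unique shorter shorter _ _ = refl
Compares-unique longer  longer  _ _ = refl
Compares-unique equal   shorter p q = contradiction p (ℕ.<⇒≢ q)
Compares-unique equal   longer  p q = contradiction (sym p) (ℕ.<⇒≢ q)
Compares-unique shorter equal   p q = contradiction q (ℕ.<⇒≢ p)
Compares-unique shorter longer  p q = contradiction q (ℕ.<-asym p)
Compares-unique longer  equal   p q = contradiction (sym q) (ℕ.<⇒≢ p)
Compares-unique longer  shorter p q = contradiction q (ℕ.<-asym p)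

-- When one value is a proper prefix of the other, the eliminated variable is reused as the name of
-- the nonempty remainder.
elementary : Comparison → Var → Var → Substitution binary
elementary equal   x y = idₛ [ y ↦ var x ]
elementary shorter x y = idₛ [ y ↦ f (var x) (var y) ]
elementary longer  x y = idₛ [ x ↦ f (var y) (var x) ]

common : Comparison → Var → Var → Var
common equal   x y = x
common shorter x y = x
common longer  x y = y

restˡ restʳ : Comparison → Var → Var → List Var
restˡ equal   x y = []
restˡ shorter x y = []
restˡ longer  x y = [ x ]
restʳ equal   x y = []
restʳ shorter x y = [ y ]
restʳ longer  x y = []

elementaryˡ : ∀ k {x y} → x ≢ y → letters (elementary k x y) x ≡ common k x y ∷ restˡ k x y
elementaryˡ equal           x≢y = cong word (updated-off idₛ _ x≢y)
elementaryˡ shorter         x≢y = cong word (updated-off idₛ _ x≢y)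
elementaryˡ longer  {x}     x≢y = cong word (updated-at idₛ x _)

elementaryʳ : ∀ k {x y} → x ≢ y → letters (elementary k x y) y ≡ common k x y ∷ restʳ k x y
elementaryʳ equal   {_} {y} x≢y = cong word (updated-at idₛ y _)
elementaryʳ shorter {_} {y} x≢y = cong word (updated-at idₛ y _)
elementaryʳ longer          x≢y = cong word (updated-off idₛ _ (x≢y ∘ sym))

infixr 8 _⟨_⟩ʷ

_⟨_⟩ʷ : Substitution binary → WordProblem → WordProblem
σ ⟨ Γ ⟩ʷ = map (λ (u , v) → concatMap (letters σ) u , concatMap (letters σ) v) Γ

-- After the substitution both sides begin with `common k x y`; this is the problem once that letter
-- is cancelled.
residual : Comparison → Var → Var → List Var → List Var → WordProblem → WordProblem
residual k x y u v Γ =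
  (restˡ k x y ++ concatMap (letters ε) u , restʳ k x y ++ concatMap (letters ε) v) ∷ ε ⟨ Γ ⟩ʷ
  where ε = elementary k x y

infix 4 _⇝_

-- The shape of the first equation dictates the rule, so `k` is the only choice along a path. An
-- equation with exactly one empty side has no rule, as nonempty values cannot solve it.
data _⇝_ : WordProblem → Substitution binary → Set where
  done   : [] ⇝ idₛ
  drop   : ∀ {Γ σ} → Γ ⇝ σ → ([] , []) ∷ Γ ⇝ σ
  cancel : ∀ {x u v Γ σ} → (u , v) ∷ Γ ⇝ σ → (x ∷ u , x ∷ v) ∷ Γ ⇝ σ
  step   : ∀ {x y u v Γ σ} k → x ≢ y → residual k x y u v Γ ⇝ σ →
           (x ∷ u , y ∷ v) ∷ Γ ⇝ σ ∘ₛ elementary k x y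

WordUnifies-∘⁺ : ∀ σ ε Γ → WordUnifies (letters σ) (ε ⟨ Γ ⟩ʷ) → WordUnifies (letters (σ ∘ₛ ε)) Γ
WordUnifies-∘⁺ σ ε Γ w = All.map (λ {(u , v)} p → trans (concatMap-letters-∘ σ ε u)
  (trans p (sym (concatMap-letters-∘ σ ε v)))) (All.map⁻ w)

WordUnifies-∘⁻ : ∀ σ ε Γ → WordUnifies (letters (σ ∘ₛ ε)) Γ → WordUnifies (letters σ) (ε ⟨ Γ ⟩ʷ)
WordUnifies-∘⁻ σ ε Γ w = All.map⁺ (All.map (λ {(u , v)} p → trans (sym (concatMap-letters-∘ σ ε u))
  (trans p (concatMap-letters-∘ σ ε v))) w)

concatMap-split : ∀ σ ε {x c r} u → letters ε x ≡ c ∷ r →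
  concatMap (letters (σ ∘ₛ ε)) (x ∷ u) ≡
  letters σ c ++ concatMap (letters σ) (r ++ concatMap (letters ε) u)
concatMap-split σ ε {x} u eq = trans (concatMap-letters-∘ σ ε (x ∷ u))
  (cong (λ w → concatMap (letters σ) (w ++ concatMap (letters ε) u)) eq)

⇝-sound : ∀ {Γ σ} → Γ ⇝ σ → WordUnifies (letters σ) Γ
⇝-sound done       = []
⇝-sound (drop d)   = refl ∷ ⇝-sound d
⇝-sound (cancel {x} {σ = σ} d) with p ∷ w ← ⇝-sound d = cong (letters σ x ++_) p ∷ w
⇝-sound (step {x} {y} {u} {v} {Γ} {σ} k x≢y d) with p ∷ w ← ⇝-sound d =
    trans (concatMap-split σ ε u (elementaryˡ k x≢y))
      (trans (cong (letters σ (common k x y) ++_) p) (sym (concatMap-split σ ε v (elementaryʳ k x≢y))))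
  ∷ WordUnifies-∘⁺ σ ε Γ w
  where ε = elementary k x y

prefixes : ∀ (p q : List Var) {a b} → p ++ a ≡ q ++ b →
           p ≡ q ⊎ (∃₂ λ c r → q ≡ p ++ c ∷ r) ⊎ (∃₂ λ c r → p ≡ q ++ c ∷ r)
prefixes []      []      _  = inj₁ refl
prefixes []      (c ∷ q) _  = inj₂ (inj₁ (c , q , refl))
prefixes (c ∷ p) []      _  = inj₂ (inj₂ (c , p , refl))
prefixes (c ∷ p) (d ∷ q) eq with refl , eq′ ← List.∷-injective eq with prefixes p q eq′
... | inj₁ refl                 = inj₁ refl
... | inj₂ (inj₁ (_ , _ , refl)) = inj₂ (inj₁ (_ , _ , refl))
... | inj₂ (inj₂ (_ , _ , refl)) = inj₂ (inj₂ (_ , _ , refl))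

factor-prefix : ∀ θ {x y} c r → x ≢ y → letters θ y ≡ letters θ x ++ c ∷ r →
  letters (θ [ y ↦ term (c ∷ r) ] ∘ₛ idₛ [ y ↦ f (var x) (var y) ]) ≗ letters θ
factor-prefix θ {x} {y} c r x≢y eq z with z ℕ.≟ y
... | no z≢y   = cong word (updated-off θ _ z≢y)
... | yes refl = begin
  word (fun θ′ x) ++ word (fun θ′ y)        ≡⟨ cong₂ (λ s t → word s ++ word t)
                                                     (updated-off θ _ x≢y) (updated-at θ y _) ⟩
  letters θ x ++ word (term (c ∷ r))        ≡⟨ cong (letters θ x ++_) (word-term c r) ⟩
  letters θ x ++ c ∷ r                      ≡⟨ eq ⟨
  letters θ y                               ∎
  where
  open ≡-Reasoning
  θ′ = θ [ y ↦ term (c ∷ r) ]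

-- Both values are prefixes of one word, so one extends the other. In the strict cases `θ′` gives
-- the eliminated variable the remainder, which is nonempty and hence the word of a term.
factor : ∀ θ {x y a b} → x ≢ y → letters θ x ++ a ≡ letters θ y ++ b →
         ∃₂ λ k θ′ → letters (θ′ ∘ₛ elementary k x y) ≗ letters θ
factor θ {x} {y} x≢y eq with prefixes (letters θ x) (letters θ y) eq
... | inj₂ (inj₁ (c , r , eq′)) = shorter , θ [ y ↦ term (c ∷ r) ] , factor-prefix θ c r x≢y eq′
... | inj₂ (inj₂ (c , r , eq′)) = longer , θ [ x ↦ term (c ∷ r) ] , factor-prefix θ c r (x≢y ∘ sym) eq′
... | inj₁ eq′                  = equal , θ , same
  where
  same : letters (θ ∘ₛ idₛ [ y ↦ var x ]) ≗ letters θ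
  same z with z ℕ.≟ y
  ... | yes refl = eq′
  ... | no  _    = refl

wordWeight : (Var → List Var) → WordProblem → ℕ
wordWeight g []            = 0
wordWeight g ((u , _) ∷ Γ) = length (concatMap g u) + wordWeight g Γ

wordWeight-cong : ∀ {g h} → g ≗ h → wordWeight g ≗ wordWeight h
wordWeight-cong eq []            = refl
wordWeight-cong eq ((u , _) ∷ Γ) =
  cong₂ _+_ (cong length (List.concatMap-cong eq u)) (wordWeight-cong eq Γ)

wordWeight-∘ : ∀ σ ε Γ → wordWeight (letters σ) (ε ⟨ Γ ⟩ʷ) ≡ wordWeight (letters (σ ∘ₛ ε)) Γ
wordWeight-∘ σ ε []            = refl
wordWeight-∘ σ ε ((u , _) ∷ Γ) =
  cong₂ _+_ (cong length (sym (concatMap-letters-∘ σ ε u))) (wordWeight-∘ σ ε Γ)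

WordUnifies-cong : ∀ {g h} → g ≗ h → WordUnifies g ⊆ WordUnifies h
WordUnifies-cong eq = All.map λ {(u , v)} p →
  trans (sym (List.concatMap-cong eq u)) (trans p (List.concatMap-cong eq v))

shrinks : ∀ (p q : List Var) {m n} → 0 < length p → length (p ++ q) + m < suc n → length q + m < n
shrinks (_ ∷ p) q {m} _ (s≤s w) = ℕ.≤-<-trans
  (ℕ.+-monoˡ-≤ m (ℕ.≤-trans (ℕ.m≤n+m _ (length p)) (ℕ.≤-reflexive (sym (List.length-++ p))))) w

-- As for syntactic unification, each step except drop decreases the weight of Γ
-- under the unifier θ, up to replacing θ by its factor.
⇝-complete : ∀ n Γ θ → WordUnifies (letters θ) Γ → wordWeight (letters θ) Γ < n →
             ∃[ σ ] Γ ⇝ σ × ∃[ δ ] letters (δ ∘ₛ σ) ≗ letters θ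
⇝-complete n [] θ _ _ = idₛ , done , θ , λ _ → refl
⇝-complete n (([] , []) ∷ Γ) θ (_ ∷ u) w =
  let σ , d , σ≤θ = ⇝-complete n Γ θ u w in σ , drop d , σ≤θ
⇝-complete n (([] , y ∷ v) ∷ Γ) θ (p ∷ _) _ = contradiction (sym p) (letters-++≢[] θ y _)
⇝-complete n ((x ∷ u , []) ∷ Γ) θ (p ∷ _) _ = contradiction p (letters-++≢[] θ x _)
⇝-complete (suc n) ((x ∷ u , y ∷ v) ∷ Γ) θ (p ∷ uΓ) w with x ℕ.≟ y
... | yes refl =
  let σ , d , σ≤θ = ⇝-complete n ((u , v) ∷ Γ) θ (List.++-cancelˡ (letters θ x) _ _ p ∷ uΓ)
                      (shrinks (letters θ x) (concatMap (letters θ) u) (0<length-word (fun θ x)) w)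
  in σ , cancel d , σ≤θ
... | no x≢y =
  let k , θ′ , eq = factor θ x≢y p
      ε  = elementary k x y
      c  = common k x y
      -- The equation `p` rewritten under `θ′ ∘ₛ ε`, where both sides begin with the value of `c`.
      -- Cancelling this nonempty value yields the residual equation and lowers the weight.
      p′ = trans (sym (concatMap-split θ′ ε u (elementaryˡ k x≢y)))
             (trans (List.concatMap-cong eq (x ∷ u))
               (trans p (trans (sym (List.concatMap-cong eq (y ∷ v)))
                 (concatMap-split θ′ ε v (elementaryʳ k x≢y)))))
      w′ = subst (_< suc n)
             (cong₂ _+_
               (cong length (trans (sym (List.concatMap-cong eq (x ∷ u)))
                                   (concatMap-split θ′ ε u (elementaryˡ k x≢y))))
               (sym (trans (wordWeight-∘ θ′ ε Γ) (wordWeight-cong eq Γ)))) w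
      σ , d , δ , eq′ = ⇝-complete n (residual k x y u v Γ) θ′
        (List.++-cancelˡ (letters θ′ c) _ _ p′ ∷ WordUnifies-∘⁻ θ′ ε Γ (WordUnifies-cong (sym ∘ eq) uΓ))
        (shrinks (letters θ′ c) _ (0<length-word (fun θ′ c)) w′)
  in σ ∘ₛ ε , step k x≢y d , δ , λ z → begin
    word (δ ⟨ σ ⟨ fun ε z ⟩ ⟩)                  ≡⟨ cong word (∘ₛ-⟨⟩ δ σ (fun ε z)) ⟨
    word ((δ ∘ₛ σ) ⟨ fun ε z ⟩)                 ≡⟨ word-⟨⟩ (δ ∘ₛ σ) (fun ε z) ⟩
    concatMap (letters (δ ∘ₛ σ)) (letters ε z)  ≡⟨ List.concatMap-cong eq′ (letters ε z) ⟩
    concatMap (letters θ′) (letters ε z)        ≡⟨ word-⟨⟩ θ′ (fun ε z) ⟨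
    letters (θ′ ∘ₛ ε) z                         ≡⟨ eq z ⟩
    letters θ z                                 ∎
  where open ≡-Reasoning

Agree : (g h : Var → List Var) → Pred Var 0ℓ
Agree g h z = g z ≡ h z

-- Only the letters of the problem are consulted, so that a comparison on `VarOf Γ` is already
-- enough for determinism.
AgreeOn : (g h : Var → List Var) → Pred WordProblem 0ℓ
AgreeOn g h = All λ (u , v) → All (Agree g h) u × All (Agree g h) v

compares-rest : ∀ γ k x y → let c = letters γ (common k x y) in
  Compares k (length (c ++ concatMap (letters γ) (restˡ k x y)))
             (length (c ++ concatMap (letters γ) (restʳ k x y)))
compares-rest γ k x y = by k
  where
  appended : ∀ p z → length (p ++ []) < length (p ++ letters γ z ++ [])
  appended p z rewrite List.++-identityʳ p | List.++-identityʳ (letters γ z)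
                     | List.length-++ p {letters γ z} = ℕ.m<m+n _ (0<length-word (fun γ z))

  by : ∀ k → let c = letters γ (common k x y) in
       Compares k (length (c ++ concatMap (letters γ) (restˡ k x y)))
                  (length (c ++ concatMap (letters γ) (restʳ k x y)))
  by equal   = refl
  by shorter = appended (letters γ x) y
  by longer  = appended (letters γ y) x

-- A remainder has a nonempty value under every `γ`, so a strict inequality persists and `k` is
-- visible in every instance.
compares : ∀ γ k {x y} → x ≢ y →
  Compares k (length (letters (γ ∘ₛ elementary k x y) x)) (length (letters (γ ∘ₛ elementary k x y) y))
compares γ k {x} {y} x≢y = subst₂ (Compares k)
  (cong length (sym (split (elementaryˡ k x≢y)))) (cong length (sym (split (elementaryʳ k x≢y))))
  (compares-rest γ k x y)
  where
  ε = elementary k x y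
  split : ∀ {z c r} → letters ε z ≡ c ∷ r →
          letters (γ ∘ₛ ε) z ≡ letters γ c ++ concatMap (letters γ) r
  split {z} eq = trans (word-⟨⟩ γ (fun ε z)) (cong (concatMap (letters γ)) eq)

module _ {γ γ′ : Substitution binary} where

  agree-at : ∀ ε {z t} → fun ε z ≡ t → Agree (letters (γ ∘ₛ ε)) (letters (γ′ ∘ₛ ε)) z →
             word (γ ⟨ t ⟩) ≡ word (γ′ ⟨ t ⟩)
  agree-at ε refl p = p

  -- Agreement on `x` and on the product that replaces `y` cancels to agreement on the remainder.
  agree-prefix : ∀ {x y} → x ≢ y → let ε = idₛ [ y ↦ f (var x) (var y) ] in
    Agree (letters (γ ∘ₛ ε)) (letters (γ′ ∘ₛ ε)) x →
    Agree (letters (γ ∘ₛ ε)) (letters (γ′ ∘ₛ ε)) y →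
    ∀ z → Agree (letters (γ ∘ₛ ε)) (letters (γ′ ∘ₛ ε)) z →
    All (Agree (letters γ) (letters γ′)) (letters ε z)
  agree-prefix {x} {y} x≢y px py z pz with z ℕ.≟ y
  ... | no _  = pz ∷ []
  ... | yes _ = qx ∷ List.++-cancelˡ (letters γ x) _ _ (trans qxy (cong (_++ letters γ′ y) (sym qx))) ∷ []
    where
    ε   = idₛ [ y ↦ f (var x) (var y) ]
    qx  = agree-at ε {x} (updated-off idₛ _ x≢y) px
    qxy = agree-at ε {y} (updated-at idₛ y _) py

  agree-elementary : ∀ k {x y} → x ≢ y → let ε = elementary k x y in
    Agree (letters (γ ∘ₛ ε)) (letters (γ′ ∘ₛ ε)) x →
    Agree (letters (γ ∘ₛ ε)) (letters (γ′ ∘ₛ ε)) y →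
    ∀ z → Agree (letters (γ ∘ₛ ε)) (letters (γ′ ∘ₛ ε)) z →
    All (Agree (letters γ) (letters γ′)) (letters ε z)
  agree-elementary shorter x≢y px py = agree-prefix x≢y px py
  agree-elementary longer  x≢y px py = agree-prefix (x≢y ∘ sym) py px
  agree-elementary equal {x} {y} x≢y px py z pz with z ℕ.≟ y
  ... | no _  = pz ∷ []
  ... | yes _ = agree-at (idₛ [ y ↦ var x ]) {x} (updated-off idₛ _ x≢y) px ∷ []

  agree-residual : ∀ k {x y u v Γ} → x ≢ y → let ε = elementary k x y in
    AgreeOn (letters (γ ∘ₛ ε)) (letters (γ′ ∘ₛ ε)) ((x ∷ u , y ∷ v) ∷ Γ) →
    AgreeOn (letters γ) (letters γ′) (residual k x y u v Γ)
  agree-residual k x≢y ((px ∷ pu , py ∷ pv) ∷ pΓ) =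
      ( All.++⁺ (All.tail (subst (All _) (elementaryˡ k x≢y) (images px))) (all-images pu)
      , All.++⁺ (All.tail (subst (All _) (elementaryʳ k x≢y) (images py))) (all-images pv))
    ∷ All.map⁺ (All.map (λ (pu , pv) → all-images pu , all-images pv) pΓ)
    where
    images     = λ {z} → agree-elementary k x≢y px py z
    all-images = λ {u} (pu : All _ u) → All.concat⁺ (All.map⁺ (All.map images pu))

AgreeOn-assoc : ∀ α σ ε β τ ε′ → AgreeOn (letters (α ∘ₛ σ ∘ₛ ε)) (letters (β ∘ₛ τ ∘ₛ ε′)) ⊆
                                AgreeOn (letters ((α ∘ₛ σ) ∘ₛ ε)) (letters ((β ∘ₛ τ) ∘ₛ ε′))
AgreeOn-assoc α σ ε β τ ε′ = All.map λ (pu , pv) → All.map reassociate pu , All.map reassociate pv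
  where
  reassociate : ∀ {z} → Agree (letters (α ∘ₛ σ ∘ₛ ε)) (letters (β ∘ₛ τ ∘ₛ ε′)) z →
                Agree (letters ((α ∘ₛ σ) ∘ₛ ε)) (letters ((β ∘ₛ τ) ∘ₛ ε′)) z
  reassociate {z} p = trans (cong word (∘ₛ-⟨⟩ α σ (fun ε z)))
    (trans p (cong word (sym (∘ₛ-⟨⟩ β τ (fun ε′ z)))))

-- The comparison in each step can be read off any instance of the solution.
⇝-deterministic : ∀ {Γ σ τ} → Γ ⇝ σ → Γ ⇝ τ → ∀ α β →
                  AgreeOn (letters (α ∘ₛ σ)) (letters (β ∘ₛ τ)) Γ → σ ≡ τ
⇝-deterministic done       done        α β _       = refl
⇝-deterministic (drop d)   (drop d′)   α β (_ ∷ p) = ⇝-deterministic d d′ α β p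
⇝-deterministic (cancel d) (cancel d′) α β ((_ ∷ pu , _ ∷ pv) ∷ p) =
  ⇝-deterministic d d′ α β ((pu , pv) ∷ p)
⇝-deterministic (cancel d) (step k x≢x d′) α β _ = contradiction refl x≢x
⇝-deterministic (step k x≢x d) (cancel d′) α β _ = contradiction refl x≢x
⇝-deterministic (step {x} {y} {σ = σ} k x≢y d) (step {σ = τ} k′ _ d′) α β p
  with p′ ← AgreeOn-assoc α σ (elementary k x y) β τ (elementary k′ x y) p
  -- The two instances agree at `x` and `y`, so both comparisons concern the same two lengths.
  with refl ← Compares-unique k k′
    (compares (α ∘ₛ σ) k x≢y)
    (subst₂ (Compares k′) (cong length (sym (All.head (proj₁ (All.head p′)))))
                          (cong length (sym (All.head (proj₂ (All.head p′)))))
      (compares (β ∘ₛ τ) k′ x≢y)) =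
  cong (_∘ₛ elementary k x y) (⇝-deterministic d d′ α β (agree-residual {α ∘ₛ σ} {β ∘ₛ τ} k x≢y p′))

All-word : ∀ {P : Pred Var 0ℓ} t → (∀ {x} → Occurs x t → P x) → All P (word t)
All-word (var x)                p = p here ∷ []
All-word (op zero (s ∷ t ∷ [])) p = All.++⁺
  (All-word s λ o → p (there (VecAny.here o)))
  (All-word t λ o → p (there (VecAny.there (VecAny.here o))))

All-words : ∀ {P : Pred Var 0ℓ} Γ → (∀ {x} → VarOf Γ x → P x) →
            All (λ (u , v) → All P u × All P v) (words Γ)
All-words []            p = []
All-words ((s , t) ∷ Γ) p =
    (All-word s (λ o → p (here (inj₁ o))) , All-word t (λ o → p (here (inj₂ o))))
  ∷ All-words Γ λ o → p (there o)

-- The unification type of A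

Derived : Problem binary → Set
Derived Γ = ∃[ σ ] words Γ ⇝ σ

derived-complete : ∀ Γ → IsComplete {E = A} {Γ} U (proj₁ {B = words Γ ⇝_})
derived-complete Γ = record
  { unifiers = λ (σ , d) → WordUnifies⇒IsUnifier σ Γ (⇝-sound d)
  ; complete = λ θ u →
      let σ , d , δ , eq = ⇝-complete _ (words Γ) θ (IsUnifier⇒WordUnifies θ Γ u) (ℕ.n<1+n _)
      in (σ , d) , δ , λ z _ → word-injective (δ ⟨ fun σ z ⟩) (fun θ z) (eq z)
  }

-- A comparison by `δ` makes `δ ∘ₛ σ` agree with `idₛ ∘ₛ τ` on the variables of `Γ`, and determinism
-- identifies the solutions. Leaving `X` open covers both notions of type at once.
derived-isMinimalComplete : ∀ Γ {X} → VarOf Γ ⊆ X →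
  IsMinimalComplete A Γ X (Range {E = A} (proj₁ {B = words Γ ⇝_}))
derived-isMinimalComplete Γ {X} Γ⊆X =
  range-isMinimalComplete (IsComplete-antimono (λ _ → _) (derived-complete Γ)) minimal
  where
  minimal : ∀ (i j : Derived Γ) → MoreGeneral A X (proj₁ i) (proj₁ j) → proj₁ i ≐ proj₁ j
  minimal (σ , d) (τ , d′) (δ , p) = cong-app (cong fun (⇝-deterministic d d′ δ idₛ
    (All-words Γ λ {x} x∈ → trans (word-cong {δ ⟨ fun σ x ⟩} {fun τ x} (p x (Γ⊆X x∈)))
                                  (cong word (sym (extend-var (fun τ x)))))))

xy≈yx : Problem binary
xy≈yx = [ f (var 0) (var 1) , f (var 1) (var 0) ]

-- Replacing `y` by `xy` in `xy ≈ yx` and cancelling `x` reproduces the equation, so the `shorter`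
-- step can be repeated. The solution keeps `x` and sends `y` to the word x^(n+1).
power : ℕ → Derived xy≈yx
power zero    = _ , step equal (λ ()) (cancel (drop done))
power (suc n) = _ , step shorter (λ ()) (proj₂ (power n))

length-power : ∀ n → letters (proj₁ (power n)) 0 ≡ [ 0 ] × length (letters (proj₁ (power n)) 1) ≡ suc n
length-power zero    = refl , refl
length-power (suc n) with p , q ← length-power n =
  p , trans (List.length-++ (letters (proj₁ (power n)) 0)) (cong₂ _+_ (cong length p) q)

power-injective : ∀ {m n} → proj₁ (power m) ≐ proj₁ (power n) → m ≡ n
power-injective {m} {n} eq = ℕ.suc-injective
  (trans (sym (proj₂ (length-power m))) (trans (cong (length ∘ word) (eq 1)) (proj₂ (length-power n))))

infinite : ¬ Finite (Range {E = A} (proj₁ {B = words xy≈yx ⇝_}))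
infinite (n , bij) =
  -- A bijection with `Fin n` would place the `n + 1` distinct solutions `power 0`, ..., `power n`
  -- at only `n` indices.
  let i , j , i<j , eq = Fin.pigeonhole (ℕ.n<1+n n) (to⁻ ∘ element ∘ toℕ) in
  ℕ.<⇒≢ i<j (power-injective λ x → begin
    fun (proj₁ (power (toℕ i))) x             ≡⟨ to∘to⁻ (element (toℕ i)) x ⟨
    fun (proj₁ (to (to⁻ (element (toℕ i))))) x  ≡⟨ cong (λ k → fun (proj₁ (to k)) x) eq ⟩
    fun (proj₁ (to (to⁻ (element (toℕ j))))) x  ≡⟨ to∘to⁻ (element (toℕ j)) x ⟩
    fun (proj₁ (power (toℕ j))) x             ∎)
  where
  open ≡-Reasoning
  open Surjection (Bijection.surjection bij) using (to; to⁻; to∘to⁻)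

  element : ℕ → ∃ (Range {E = A} (proj₁ {B = words xy≈yx ⇝_}))
  element n = proj₁ (power n) , lift (power n , λ _ → refl)

coincide-A : TypesCoincide A
coincide-A = infinitary
  , ((xy≈yx , solvable , type id) , worst id)
  , ((xy≈yx , solvable , type (λ _ → _)) , worst (λ _ → _))
  where
  solvable : Solvable A xy≈yx
  solvable = proj₁ (power 0) , IsComplete.unifiers (derived-complete xy≈yx) (power 0)

  type : ∀ {X} → VarOf xy≈yx ⊆ X → HasType A xy≈yx X infinitary
  type Γ⊆X = _ , derived-isMinimalComplete xy≈yx Γ⊆X , infinite

  worst : ∀ {X : Problem binary → Pred Var 0ℓ} → (∀ {Γ} → VarOf Γ ⊆ X Γ) → ∀ Γ → Solvable A Γ →
          ∀ τ → HasType A Γ (X Γ) τ → τ ≤ᵗ infinitary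
  worst Γ⊆X Γ _ unitary    _   = z≤n
  worst Γ⊆X Γ _ finitary   _   = s≤s z≤n
  worst Γ⊆X Γ _ infinitary _   = s≤s (s≤s z≤n)
  -- The derived solutions give every problem a minimal complete set.
  worst Γ⊆X Γ _ typeZero   ¬mc = contradiction (_ , derived-isMinimalComplete Γ Γ⊆X) ¬mc

corollary4p6 : ((Sg : Signature) → TypesCoincide {Sg} ∅) ×
    TypesCoincide C × TypesCoincide A × TypesCoincide I
corollary4p6 = coincide-∅ , Commutative.coincide-C , coincide-A , Idempotent.coincide-I
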